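{- For all integers $n\ge 1$ and any integer partition $\lambda$, the independence polynomial of the pineapple graph $Pi(n,\lambda)$ is log-concave.
   Context: For a partition $\lambda=(\lambda_1,\ldots,\lambda_\ell)$, the spider $S(\lambda)$ is the tree consisting of a vertex (the torso) together with $\ell$ pairwise disjoint paths (legs) having $\lambda_1,\ldots,\lambda_\ell$ vertices respectively, where one end vertex of each leg is joined by an edge to the torso. The pineapple graph $Pi(n,\lambda)$ is the graph obtained by identifying a vertex of the complete graph $K_n$ with the torso of $S(\lambda)$ (so for $n=1$ it is $S(\lambda)$ itself). For a finite simple graph $G$, the independence polynomial is $I_G(t)=\sum_{j=0}^{\alpha(G)} i_jt^j$, where $i_j$ is the number of independent sets of $G$ of cardinality $j$ ($i_0=1$) and $\alpha(G)$ is the maximum size of an independent set. A polynomial $a_0+a_1t+\cdots+a_dt^d$ is log-concave if $a_j^2\ge a_{j-1}a_{j+1}$ for all $1\le j\le d-1$. -}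

module Defs where

open import Data.Empty using (⊥)
open import Data.Fin using (Fin; zero; suc; toℕ)
import Data.Fin.Properties as Fin
open import Data.List using (List; []; _∷_; _++_; map; length; lookup; filter; allFin; upTo; catMaybes)
open import Data.List.Extrema.Nat using (max)
open import Data.List.Membership.Propositional using (_∈_)
open import Data.List.Membership.Propositional.Properties
  using (∈-map⁺; ∈-map⁻; ∈-++⁺ˡ; ∈-++⁺ʳ; ∈-allFin)
open import Data.List.Relation.Binary.Disjoint.Propositional using (Disjoint)
open import Data.List.Relation.Unary.All as All using (All; []; _∷_)
import Data.List.Relation.Unary.All.Properties as All
open import Data.List.Relation.Unary.AllPairs using (AllPairs; []; _∷_; allPairs?)
open import Data.List.Relation.Unary.Any using (here; there)
open import Data.List.Relation.Unary.Linked using (Linked)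
open import Data.List.Relation.Unary.Unique.Propositional using (Unique)
import Data.List.Relation.Unary.Unique.Propositional.Properties as Unique
open import Data.Maybe using (Maybe; just; nothing)
import Data.Maybe.Properties as Maybe
open import Data.Nat using (ℕ; zero; suc; _∸_; _*_; _^_; _≤_; _≥_; _<_; _≟_; NonZero)
open import Data.Nat.Properties using (1+n≢n)
open import Data.Product using (Σ-syntax; _×_; _,_)
import Data.Product.Properties as Product
open import Data.Sum using (_⊎_; inj₁; inj₂; swap; [_,_])
import Data.Sum.Properties as Sum
open import Relation.Binary using (Rel; Decidable; DecidableEquality; Symmetric; Irreflexive)
open import Relation.Binary.PropositionalEquality using (_≡_; _≢_; refl; sym; ≢-sym)
open import Relation.Nullary using (¬_; Dec; yes; no; ¬?)
open import Relation.Nullary.Decidable using (_×-dec_; _⊎-dec_)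
open import Level using (0ℓ)

record Graph (V : Set) : Set₁ where
  field
    Adj      : Rel V 0ℓ
    symm     : Symmetric Adj
    irrefl   : Irreflexive _≡_ Adj
    adj?     : Decidable Adj
    eq?      : DecidableEquality V
    vertices : List V
    unique   : Unique vertices
    complete : ∀ v → v ∈ vertices

-- If xs has no repetitions, every subset of its elements occurs exactly once in
-- sublists xs, listed in the order of xs.
sublists : {A : Set} → List A → List (List A)
sublists []       = [] ∷ []
sublists (x ∷ xs) = sublists xs ++ map (x ∷_) (sublists xs)

-- The polynomial a₀ + a₁ t + ⋯ + a_d t^d is the list a₀ ∷ a₁ ∷ ⋯ ∷ a_d ∷ [].
Polynomial : Set
Polynomial = List ℕ

coeff : Polynomial → ℕ → ℕ
coeff []      _       = 0
coeff (a ∷ _) zero    = a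
coeff (_ ∷ p) (suc j) = coeff p j

-- A list of length d + 1 makes  suc j < length p  the bound  j ≤ d - 1.
LogConcave : Polynomial → Set
LogConcave p = ∀ j → 1 ≤ j → suc j < length p →
  coeff p j ^ 2 ≥ coeff p (j ∸ 1) * coeff p (suc j)

module _ {V : Set} (G : Graph V) where
  open Graph G

  -- Adjacency is symmetric, so it is enough to compare each element with the
  -- later ones.
  Independent : List V → Set
  Independent = AllPairs (λ u v → ¬ Adj u v)

  independent? : ∀ s → Dec (Independent s)
  independent? = allPairs? (λ u v → ¬? (adj? u v))

  independentSets : List (List V)
  independentSets = filter independent? (sublists vertices)

  independentSetCount : ℕ → ℕ
  independentSetCount j = length (filter (λ s → length s ≟ j) independentSets)

  independenceNumber : ℕ
  independenceNumber = max 0 (map length independentSets)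

  independencePolynomial : Polynomial
  independencePolynomial = map independentSetCount (upTo (suc independenceNumber))

completeGraph : ∀ n → Graph (Fin n)
completeGraph n = record
  { Adj      = _≢_
  ; symm     = ≢-sym
  ; irrefl   = λ u≡v u≢v → u≢v u≡v
  ; adj?     = λ u v → ¬? (u Fin.≟ v)
  ; eq?      = Fin._≟_
  ; vertices = allFin n
  ; unique   = Unique.allFin⁺ n
  ; complete = ∈-allFin
  }

record Partition : Set where
  field
    parts      : List ℕ
    positive   : All (0 <_) parts
    decreasing : Linked _≥_ parts

-- (i , j) is the vertex at distance j + 1 from the torso on the i-th leg.
LegVertex : List ℕ → Set
LegVertex ks = Σ[ i ∈ Fin (length ks) ] Fin (lookup ks i)

legVertex-suc : ∀ k ks → LegVertex ks → LegVertex (k ∷ ks)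
legVertex-suc k ks (i , j) = suc i , j

legVertices : ∀ ks → List (LegVertex ks)
legVertices []       = []
legVertices (k ∷ ks) = map (zero ,_) (allFin k) ++ map (legVertex-suc k ks) (legVertices ks)

legVertices-unique : ∀ ks → Unique (legVertices ks)
legVertices-unique []       = []
legVertices-unique (k ∷ ks) =
  Unique.++⁺ (Unique.map⁺ (λ { refl → refl }) (Unique.allFin⁺ k))
             (Unique.map⁺ (λ { refl → refl }) (legVertices-unique ks))
             disjoint
  where
  disjoint : Disjoint (map (zero ,_) (allFin k)) (map (legVertex-suc k ks) (legVertices ks))
  disjoint (p , q) with ∈-map⁻ _ p | ∈-map⁻ _ q
  ... | _ , _ , refl | _ , _ , ()

legVertices-complete : ∀ ks v → v ∈ legVertices ks
legVertices-complete (k ∷ ks) (zero  , j) = ∈-++⁺ˡ (∈-map⁺ _ (∈-allFin j))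
legVertices-complete (k ∷ ks) (suc i , j) =
  ∈-++⁺ʳ (map (zero ,_) (allFin k)) (∈-map⁺ (legVertex-suc k ks) (legVertices-complete ks (i , j)))

-- The torso is  nothing.  Each edge is oriented away from the torso.
SpiderEdge : ∀ ks → Rel (Maybe (LegVertex ks)) 0ℓ
SpiderEdge ks nothing        (just (_ , j))  = toℕ j ≡ 0
SpiderEdge ks (just (i , j)) (just (i′ , k)) = i ≡ i′ × toℕ k ≡ suc (toℕ j)
SpiderEdge ks _              nothing         = ⊥

spiderEdge? : ∀ ks → Decidable (SpiderEdge ks)
spiderEdge? ks nothing        (just (_ , j))  = toℕ j ≟ 0
spiderEdge? ks (just (i , j)) (just (i′ , k)) = (i Fin.≟ i′) ×-dec (toℕ k ≟ suc (toℕ j))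
spiderEdge? ks nothing        nothing         = no λ ()
spiderEdge? ks (just _)       nothing         = no λ ()

spiderEdge-irrefl : ∀ ks u → ¬ SpiderEdge ks u u
spiderEdge-irrefl ks (just _) (_ , j≡1+j) = 1+n≢n (sym j≡1+j)

spider : (μ : Partition) → Graph (Maybe (LegVertex (Partition.parts μ)))
spider μ = record
  { Adj      = λ u v → SpiderEdge ks u v ⊎ SpiderEdge ks v u
  ; symm     = swap
  ; irrefl   = λ { {u} refl → [ spiderEdge-irrefl ks u , spiderEdge-irrefl ks u ] }
  ; adj?     = λ u v → spiderEdge? ks u v ⊎-dec spiderEdge? ks v u
  ; eq?      = Maybe.≡-dec (Product.≡-dec Fin._≟_ Fin._≟_)
  ; vertices = nothing ∷ map just (legVertices ks)
  ; unique   = All.map⁺ (All.universal (λ _ ()) (legVertices ks))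
               ∷ Unique.map⁺ Maybe.just-injective (legVertices-unique ks)
  ; complete = λ { nothing  → here refl
                 ; (just v) → there (∈-map⁺ just (legVertices-complete ks v)) }
  }
  where ks = Partition.parts μ

catMaybes-fresh : {B : Set} {y : B} (ys : List (Maybe B)) →
                  All (just y ≢_) ys → All (y ≢_) (catMaybes ys)
catMaybes-fresh []             []       = []
catMaybes-fresh (just _  ∷ ys) (n ∷ ns) = (λ { refl → n refl }) ∷ catMaybes-fresh ys ns
catMaybes-fresh (nothing ∷ ys) (_ ∷ ns) = catMaybes-fresh ys ns

catMaybes-unique : {B : Set} (ys : List (Maybe B)) → Unique ys → Unique (catMaybes ys)
catMaybes-unique []             []       = []
catMaybes-unique (just _  ∷ ys) (n ∷ ns) = catMaybes-fresh ys n ∷ catMaybes-unique ys ns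
catMaybes-unique (nothing ∷ ys) (_ ∷ ns) = catMaybes-unique ys ns

catMaybes-complete : {B : Set} {y : B} (ys : List (Maybe B)) → just y ∈ ys → y ∈ catMaybes ys
catMaybes-complete (just _  ∷ ys) (here refl) = here refl
catMaybes-complete (just _  ∷ ys) (there p)   = there (catMaybes-complete ys p)
catMaybes-complete (nothing ∷ ys) (there p)   = catMaybes-complete ys p

-- The graph obtained from the disjoint union of G and H by identifying the
-- vertex g of G with the vertex  nothing  of H.
module _ {A B : Set} (G : Graph A) (g : A) (H : Graph (Maybe B)) where
  private
    module G = Graph G
    module H = Graph H

  GlueAdj : Rel (A ⊎ B) 0ℓ
  GlueAdj (inj₁ u) (inj₁ v) = G.Adj u v
  GlueAdj (inj₁ u) (inj₂ y) = u ≡ g × H.Adj nothing (just y)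
  GlueAdj (inj₂ x) (inj₁ v) = v ≡ g × H.Adj (just x) nothing
  GlueAdj (inj₂ x) (inj₂ y) = H.Adj (just x) (just y)

  glue-symm : Symmetric GlueAdj
  glue-symm {inj₁ _} {inj₁ _} a       = G.symm a
  glue-symm {inj₁ _} {inj₂ _} (e , a) = e , H.symm a
  glue-symm {inj₂ _} {inj₁ _} (e , a) = e , H.symm a
  glue-symm {inj₂ _} {inj₂ _} a       = H.symm a

  glue-irrefl : Irreflexive _≡_ GlueAdj
  glue-irrefl {inj₁ _} refl = G.irrefl refl
  glue-irrefl {inj₂ _} refl = H.irrefl refl

  glueVertices : List (A ⊎ B)
  glueVertices = map inj₁ G.vertices ++ map inj₂ (catMaybes H.vertices)

  glue-disjoint : Disjoint (map inj₁ G.vertices) (map inj₂ (catMaybes H.vertices))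
  glue-disjoint (p , q) with ∈-map⁻ _ p | ∈-map⁻ _ q
  ... | _ , _ , refl | _ , _ , ()

  glueAdj? : Decidable GlueAdj
  glueAdj? (inj₁ u) (inj₁ v) = G.adj? u v
  glueAdj? (inj₁ u) (inj₂ y) = G.eq? u g ×-dec H.adj? nothing (just y)
  glueAdj? (inj₂ x) (inj₁ v) = G.eq? v g ×-dec H.adj? (just x) nothing
  glueAdj? (inj₂ x) (inj₂ y) = H.adj? (just x) (just y)

  justEq? : DecidableEquality B
  justEq? x y with H.eq? (just x) (just y)
  ... | yes refl = yes refl
  ... | no  x≢y  = no λ { refl → x≢y refl }

  glue : Graph (A ⊎ B)
  glue = record
    { Adj      = GlueAdj
    ; symm     = λ {u} {v} → glue-symm {u} {v}
    ; irrefl   = λ {u} {v} → glue-irrefl {u} {v}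
    ; adj?     = glueAdj?
    ; eq?      = Sum.≡-dec G.eq? justEq?
    ; vertices = glueVertices
    ; unique   = Unique.++⁺ (Unique.map⁺ Sum.inj₁-injective G.unique)
                            (Unique.map⁺ Sum.inj₂-injective (catMaybes-unique H.vertices H.unique))
                            glue-disjoint
    ; complete = λ { (inj₁ u) → ∈-++⁺ˡ (∈-map⁺ inj₁ (G.complete u))
                   ; (inj₂ y) → ∈-++⁺ʳ (map inj₁ G.vertices)
                                       (∈-map⁺ inj₂ (catMaybes-complete H.vertices (H.complete (just y)))) }
    }

pineapple : ∀ n .{{_ : NonZero n}} (μ : Partition) →
            Graph (Fin n ⊎ LegVertex (Partition.parts μ))
pineapple n@(suc _) μ = glue (completeGraph n) zero (spider μ)

{-# OPTIONS --safe #-}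

-- Let A and B be the products of the independence polynomials of the legs and of
-- the legs without their first vertices, so that the pineapple graph has
-- I(t) = (1 + (n - 1) t) A(t) + t B(t).  The coefficient of x^k y^(k+1) in
-- (y - x) I(x) I(y) is i_k² - i_{k-1} i_{k+1}, so it is enough that multiplication
-- by I(x) I(y) preserves the antisymmetric arrays that are nonnegative above the
-- diagonal.  Such multipliers form a cone closed under products that contains
-- s = x + y, p = xy and s² - p.
--
-- For a leg with L vertices, P_{L-1}(x) P_L(y) = E + y O and P_L(x) P_L(y) = E + N
-- with E, N, O in the cone.  Hence I(x) I(y) has cross terms
-- y ∏ (E_i + x O_i) + x ∏ (E_i + y O_i), whose only negative contributions come from
-- taking O in at least three legs.  They are absorbed by A(x) A(y) = ∏ (E_i + N_i),
-- because N_i N_j N_k - p² O_i O_j O_k lies in the cone; this is proved by shortening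
-- the three legs simultaneously by two vertices.  The cross terms that are linear in
-- n - 1 are treated like those of a spider with one more leg, of a single vertex.

module Submission where

open import Algebra.Bundles using (CommutativeRing)
import Algebra.Solver.Ring as RingSolver
open import Algebra.Solver.Ring.AlmostCommutativeRing
  using (fromCommutativeRing; _-Raw-AlmostCommutative⟶_)
open import Data.Bool using (if_then_else_; true; false)
open import Data.Fin using (Fin; zero; suc; toℕ)
import Data.Fin.Properties as Fin
open import Data.Integer as ℤ using (ℤ; +_; 0ℤ; 1ℤ; -1ℤ)
import Data.Integer.Properties as ℤ
open import Data.Integer.Tactic.RingSolver using (solve-∀)
open import Data.List
  using (List; []; _∷_; _++_; map; foldr; filter; length; allFin; tabulate; catMaybes; applyUpTo; upTo)
open import Data.List.Properties
  using (filter-++; filter-≐; filter-all; filter-none; filter-accept; filter-reject; length-filter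
        ; length-map; length-tabulate; length-applyUpTo; map-++; map-∘; map-tabulate; ++-identityʳ)
open import Data.List.Relation.Unary.All as All using (All; []; _∷_; all?)
import Data.List.Relation.Unary.All.Properties as All
open import Data.List.Relation.Unary.AllPairs as AllPairs using (AllPairs; []; _∷_; allPairs?)
import Data.List.Relation.Unary.AllPairs.Properties as AllPairs
open import Data.List.Relation.Unary.Unique.Propositional using (Unique)
import Data.List.Relation.Unary.Unique.Propositional.Properties as Unique
open import Data.Maybe using (Maybe; just; nothing)
open import Data.Nat as ℕ using (ℕ; zero; suc; s≤s; z≤n; NonZero)
import Data.Nat.Properties as ℕ
open import Data.Nat.Tactic.RingSolver using () renaming (solve-∀ to ℕ-solve-∀)
open import Data.Product using (_×_; _,_; proj₁; proj₂)
open import Data.Sum as Sum using (_⊎_; inj₁; inj₂)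
open import Function using (_∘_; id)
open import Level using (0ℓ)
open import Relation.Binary using (Rel; Decidable)
open import Relation.Binary.PropositionalEquality
  using (_≡_; _≢_; refl; sym; trans; cong; cong₂; subst; subst₂)
open import Relation.Nullary using (¬_; yes; no; ¬?)
open import Relation.Nullary.Decidable using (_⊎-dec_)
open import Relation.Unary using (Pred; ∁)
import Relation.Unary as Unary

open import Defs

-- Polynomials acting on arrays of coefficients

-- The entry at i, j stands for the coefficient of x^i y^j.
Array : Set
Array = ℕ → ℕ → ℤ

infix 4 _≐_
_≐_ : Array → Array → Set
u ≐ v = ∀ i j → u i j ≡ v i j

-- Polynomials in x and y, identified when they act equally by multiplication; this
-- makes them a commutative ring without any convolution of coefficients.
infixl 6 _⊕_
infixl 7 _⊗_
data Op : Set where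
  const   : ℤ → Op
  X Y     : Op
  _⊕_ _⊗_ : Op → Op → Op

act : Op → Array → Array
act (const c) u i       j       = c ℤ.* u i j
act X         u zero    j       = 0ℤ
act X         u (suc i) j       = u i j
act Y         u i       zero    = 0ℤ
act Y         u i       (suc j) = u i j
act (a ⊕ b)   u i       j       = act a u i j ℤ.+ act b u i j
act (a ⊗ b)   u                 = act a (act b u)

infix 4 _≈ᵒ_
-- A record and not a bare function type, so that unification can recover `a` and `b` from an
-- equation; `act` cannot be inverted.
record _≈ᵒ_ (a b : Op) : Set where
  constructor pointwise
  field at : ∀ u → act a u ≐ act b u

open _≈ᵒ_ public

act-cong : ∀ a {u v} → u ≐ v → act a u ≐ act a v
act-cong (const c) e i       j       = cong (c ℤ.*_) (e i j)
act-cong X         e zero    j       = refl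
act-cong X         e (suc i) j       = e i j
act-cong Y         e i       zero    = refl
act-cong Y         e i       (suc j) = e i j
act-cong (a ⊕ b)   e i       j       = cong₂ ℤ._+_ (act-cong a e i j) (act-cong b e i j)
act-cong (a ⊗ b)   e                 = act-cong a (act-cong b e)

act-+ : ∀ a u v → act a (λ i j → u i j ℤ.+ v i j) ≐ (λ i j → act a u i j ℤ.+ act a v i j)
act-+ (const c) u v i       j       = ℤ.*-distribˡ-+ c (u i j) (v i j)
act-+ X         u v zero    j       = refl
act-+ X         u v (suc i) j       = refl
act-+ Y         u v i       zero    = refl
act-+ Y         u v i       (suc j) = refl
act-+ (a ⊕ b)   u v i       j       =
  trans (cong₂ ℤ._+_ (act-+ a u v i j) (act-+ b u v i j)) (interchange (act a u i j) _ _ _)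
  where
  interchange : ∀ p q r s → (p ℤ.+ q) ℤ.+ (r ℤ.+ s) ≡ (p ℤ.+ r) ℤ.+ (q ℤ.+ s)
  interchange = solve-∀
act-+ (a ⊗ b)   u v i       j       =
  trans (act-cong a (act-+ b u v) i j) (act-+ a (act b u) (act b v) i j)

act-* : ∀ a c u → act a (λ i j → c ℤ.* u i j) ≐ (λ i j → c ℤ.* act a u i j)
act-* (const d) c u i       j       = swap d c (u i j)
  where
  swap : ∀ p q r → p ℤ.* (q ℤ.* r) ≡ q ℤ.* (p ℤ.* r)
  swap = solve-∀
act-* X         c u zero    j       = sym (ℤ.*-zeroʳ c)
act-* X         c u (suc i) j       = refl
act-* Y         c u i       zero    = sym (ℤ.*-zeroʳ c)
act-* Y         c u i       (suc j) = refl
act-* (a ⊕ b)   c u i       j       =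
  trans (cong₂ ℤ._+_ (act-* a c u i j) (act-* b c u i j))
        (sym (ℤ.*-distribˡ-+ c (act a u i j) (act b u i j)))
act-* (a ⊗ b)   c u i       j       =
  trans (act-cong a (act-* b c u) i j) (act-* a c (act b u) i j)

act-X : ∀ a u → act a (act X u) ≐ act X (act a u)
act-X (const c) u zero    j       = ℤ.*-zeroʳ c
act-X (const c) u (suc i) j       = refl
act-X X         u i       j       = refl
act-X Y         u zero    zero    = refl
act-X Y         u zero    (suc j) = refl
act-X Y         u (suc i) zero    = refl
act-X Y         u (suc i) (suc j) = refl
act-X (a ⊕ b)   u zero    j       = cong₂ ℤ._+_ (act-X a u zero j) (act-X b u zero j)
act-X (a ⊕ b)   u (suc i) j       = cong₂ ℤ._+_ (act-X a u (suc i) j) (act-X b u (suc i) j)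
act-X (a ⊗ b)   u i       j       = trans (act-cong a (act-X b u) i j) (act-X a (act b u) i j)

act-Y : ∀ a u → act a (act Y u) ≐ act Y (act a u)
act-Y (const c) u i       zero    = ℤ.*-zeroʳ c
act-Y (const c) u i       (suc j) = refl
act-Y X         u zero    zero    = refl
act-Y X         u zero    (suc j) = refl
act-Y X         u (suc i) zero    = refl
act-Y X         u (suc i) (suc j) = refl
act-Y Y         u i       j       = refl
act-Y (a ⊕ b)   u i       zero    = cong₂ ℤ._+_ (act-Y a u i zero) (act-Y b u i zero)
act-Y (a ⊕ b)   u i       (suc j) = cong₂ ℤ._+_ (act-Y a u i (suc j)) (act-Y b u i (suc j))
act-Y (a ⊗ b)   u i       j       = trans (act-cong a (act-Y b u) i j) (act-Y a (act b u) i j)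

-- Induction on the second factor: `act a` is linear and commutes with the two shifts `X` and `Y`,
-- which generate everything.
⊗-comm : ∀ a b → a ⊗ b ≈ᵒ b ⊗ a
⊗-comm a (const c) .at u i j = act-* a c u i j
⊗-comm a X         .at u i j = act-X a u i j
⊗-comm a Y         .at u i j = act-Y a u i j
⊗-comm a (b ⊕ c)   .at u i j =
  trans (act-+ a (act b u) (act c u) i j) (cong₂ ℤ._+_ (at (⊗-comm a b) u i j) (at (⊗-comm a c) u i j))
⊗-comm a (b ⊗ c)   .at u i j =
  trans (at (⊗-comm a b) (act c u) i j) (act-cong b (at (⊗-comm a c) u) i j)

opRing : CommutativeRing 0ℓ 0ℓ
opRing = record
  { Carrier = Op
  ; _≈_ = _≈ᵒ_
  ; _+_ = _⊕_
  ; _*_ = _⊗_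
  ; -_  = const -1ℤ ⊗_
  ; 0#  = const 0ℤ
  ; 1#  = const 1ℤ
  ; isCommutativeRing = record
    { isRing = record
      { +-isAbelianGroup = record
        { isGroup = record
          { isMonoid = record
            { isSemigroup = record
              { isMagma = record
                { isEquivalence = record
                  { refl  = pointwise λ u i j → refl
                  ; sym   = λ e → pointwise λ u i j → sym (at e u i j)
                  ; trans = λ e f → pointwise λ u i j → trans (at e u i j) (at f u i j)
                  }
                ; ∙-cong = λ e f → pointwise λ u i j → cong₂ ℤ._+_ (at e u i j) (at f u i j)
                }
              ; assoc = λ a b c → pointwise λ u i j → ℤ.+-assoc (act a u i j) (act b u i j) (act c u i j)
              }
            ; identity = (λ a → pointwise λ u i j → ℤ.+-identityˡ (act a u i j))
                       , (λ a → pointwise λ u i j → ℤ.+-identityʳ (act a u i j))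
            }
          ; inverse = (λ a → pointwise λ u i j → left (act a u i j)) , (λ a → pointwise λ u i j → right (act a u i j))
          ; ⁻¹-cong = λ e → pointwise λ u i j → cong (-1ℤ ℤ.*_) (at e u i j)
          }
        ; comm = λ a b → pointwise λ u i j → ℤ.+-comm (act a u i j) (act b u i j)
        }
      ; *-cong = λ {a} {b} {c} {d} e f → pointwise λ u i j → trans (act-cong a (at f u) i j) (at e (act d u) i j)
      ; *-assoc = λ a b c → pointwise λ u i j → refl
      ; *-identity = (λ a → pointwise λ u i j → ℤ.*-identityˡ (act a u i j))
                   , (λ a → pointwise λ u i j → act-cong a (λ k l → ℤ.*-identityˡ (u k l)) i j)
      ; distrib = (λ a b c → pointwise λ u i j → act-+ a (act b u) (act c u) i j)
                , (λ a b c → pointwise λ u i j → refl)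
      }
    ; *-comm = ⊗-comm
    }
  }
  where
  left : ∀ n → -1ℤ ℤ.* n ℤ.+ n ≡ 0ℤ
  left n = trans (cong (ℤ._+ n) (ℤ.-1*i≡-i n)) (ℤ.+-inverseˡ n)
  right : ∀ n → n ℤ.+ -1ℤ ℤ.* n ≡ 0ℤ
  right n = trans (cong (λ m → n ℤ.+ m) (ℤ.-1*i≡-i n)) (ℤ.+-inverseʳ n)

const-morphism : ℤ.+-*-rawRing -Raw-AlmostCommutative⟶ fromCommutativeRing opRing
const-morphism = record
  { ⟦_⟧    = const
  ; +-homo = λ c d → pointwise λ u i j → ℤ.*-distribʳ-+ (u i j) c d
  ; *-homo = λ c d → pointwise λ u i j → ℤ.*-assoc c d (u i j)
  ; -‿homo = λ c → pointwise λ u i j → trans (cong (ℤ._* u i j) (sym (ℤ.-1*i≡-i c))) (ℤ.*-assoc -1ℤ c (u i j))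
  ; 0-homo = pointwise λ u i j → refl
  ; 1-homo = pointwise λ u i j → refl
  }

const-≟ : ∀ c d → Maybe (const c ≈ᵒ const d)
const-≟ c d with c ℤ.≟ d
... | yes refl = just (pointwise λ u i j → refl)
... | no  _    = nothing

module Solver = RingSolver ℤ.+-*-rawRing (fromCommutativeRing opRing) const-morphism const-≟

open CommutativeRing opRing
  using (_≈_; _+_; _*_; -_; _-_; 0#; 1#; semiring; setoid; +-cong; +-congˡ; +-congʳ; *-cong; *-congˡ; *-congʳ
        ; -‿cong; +-assoc; +-identityˡ; +-identityʳ; *-comm; reflexive)
  renaming (refl to ≈-refl; sym to ≈-sym; trans to ≈-trans)
open import Algebra.Properties.Semiring.Exp semiring using (_^_)
open import Relation.Binary.Reasoning.Setoid setoid
open Solver using (solve; _:=_; _:+_; _:*_; _:-_; con)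

-- The cone of positive operators

-- As generating functions these are the formal nonnegative combinations of x^i y^j - x^j y^i with i
-- < j, that is, y - x times nonnegative combinations of two-variable Schur polynomials.
record Alternating (u : Array) : Set where
  field
    antisym : ∀ i j → u j i ≡ ℤ.- u i j
    nonneg  : ∀ i j → i ℕ.< j → 0ℤ ℤ.≤ u i j

  diagonal : ∀ i → u i i ≡ 0ℤ
  diagonal i = self-negative (u i i) (antisym i i)
    where
    self-negative : ∀ n → n ≡ ℤ.- n → n ≡ 0ℤ
    -- For nonzero `n` the two sides have different constructors.
    self-negative (+ zero)   _ = refl

  nonneg-≤ : ∀ i j → i ℕ.≤ j → 0ℤ ℤ.≤ u i j
  nonneg-≤ i j i≤j with ℕ.m≤n⇒m<n∨m≡n i≤j
  ... | inj₁ i<j  = nonneg i j i<j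
  ... | inj₂ refl = ℤ.≤-reflexive (sym (diagonal i))

open Alternating

record Positive (a : Op) : Set where
  field preserves : ∀ {u} → Alternating u → Alternating (act a u)

open Positive

positive-resp-≈ : ∀ {a b} → a ≈ b → Positive a → Positive b
positive-resp-≈ a≈b a⁺ .preserves {u} u⁺ = record
  { antisym = λ i j → trans (sym (at a≈b u j i))
                        (trans (antisym (preserves a⁺ u⁺) i j) (cong ℤ.-_ (at a≈b u i j)))
  ; nonneg  = λ i j i<j → subst (0ℤ ℤ.≤_) (at a≈b u i j) (nonneg (preserves a⁺ u⁺) i j i<j)
  }

infixl 6 _+⁺_
_+⁺_ : ∀ {a b} → Positive a → Positive b → Positive (a + b)
_+⁺_ {a} {b} a⁺ b⁺ .preserves {u} u⁺ = record
  { antisym = λ i j → trans (cong₂ ℤ._+_ (antisym (preserves a⁺ u⁺) i j) (antisym (preserves b⁺ u⁺) i j))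
                            (sym (ℤ.neg-distrib-+ (act a u i j) (act b u i j)))
  ; nonneg  = λ i j i<j → ℤ.+-mono-≤ (nonneg (preserves a⁺ u⁺) i j i<j)
                                     (nonneg (preserves b⁺ u⁺) i j i<j)
  }

infixl 7 _*⁺_
_*⁺_ : ∀ {a b} → Positive a → Positive b → Positive (a * b)
(a⁺ *⁺ b⁺) .preserves u⁺ = preserves a⁺ (preserves b⁺ u⁺)

const⁺ : ∀ n → Positive (const (+ n))
const⁺ n .preserves {u} u⁺ = record
  { antisym = λ i j → trans (cong (+ n ℤ.*_) (antisym u⁺ i j)) (sym (ℤ.neg-distribʳ-* (+ n) (u i j)))
  ; nonneg  = λ i j i<j → subst (ℤ._≤ + n ℤ.* u i j) (ℤ.*-zeroʳ (+ n))
                            (ℤ.*-monoˡ-≤-nonNeg (+ n) (nonneg u⁺ i j i<j))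
  }

infixl 8 _^⁺_
_^⁺_ : ∀ {a} → Positive a → ∀ n → Positive (a ^ n)
a⁺ ^⁺ zero  = const⁺ 1
a⁺ ^⁺ suc n = a⁺ *⁺ a⁺ ^⁺ n

s p : Op
s = X + Y
p = X * Y

act-X-nonneg : ∀ {u} → Alternating u → ∀ i j → i ℕ.< j → 0ℤ ℤ.≤ act X u i j
act-X-nonneg u⁺ zero    j       i<j = ℤ.≤-refl
act-X-nonneg u⁺ (suc i) (suc j) i<j = nonneg u⁺ i (suc j) (ℕ.m<n⇒m<1+n (ℕ.s<s⁻¹ i<j))

act-Y-nonneg : ∀ {u} → Alternating u → ∀ i j → i ℕ.< j → 0ℤ ℤ.≤ act Y u i j
act-Y-nonneg u⁺ i (suc j) (s≤s i≤j) = nonneg-≤ u⁺ i j i≤j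

-- One step back in either coordinate from strictly above the diagonal ends at worst on the
-- diagonal, where the entries vanish.
s⁺ : Positive s
s⁺ .preserves {u} u⁺ = record
  { antisym = anti
  ; nonneg  = λ i j i<j → ℤ.+-mono-≤ (act-X-nonneg u⁺ i j i<j) (act-Y-nonneg u⁺ i j i<j)
  }
  where
  swap : ∀ {a b a′ b′} → a ≡ ℤ.- a′ → b ≡ ℤ.- b′ → a ℤ.+ b ≡ ℤ.- (b′ ℤ.+ a′)
  swap {a′ = a′} {b′} refl refl = trans (ℤ.+-comm (ℤ.- a′) (ℤ.- b′)) (sym (ℤ.neg-distrib-+ b′ a′))
  anti : ∀ i j → act s u j i ≡ ℤ.- act s u i j
  anti zero    zero    = refl
  anti zero    (suc j) = swap {b′ = 0ℤ} (antisym u⁺ zero j) refl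
  anti (suc i) zero    = swap {a′ = 0ℤ} refl (antisym u⁺ i zero)
  anti (suc i) (suc j) = swap (antisym u⁺ (suc i) j) (antisym u⁺ i (suc j))

p⁺ : Positive p
p⁺ .preserves {u} u⁺ = record
  { antisym = anti
  ; nonneg  = λ { zero    j       i<j → ℤ.≤-refl
                ; (suc i) (suc j) i<j → nonneg u⁺ i j (ℕ.s<s⁻¹ i<j) }
  }
  where
  anti : ∀ i j → act p u j i ≡ ℤ.- act p u i j
  anti zero    zero    = refl
  anti zero    (suc j) = refl
  anti (suc i) zero    = refl
  anti (suc i) (suc j) = antisym u⁺ i j

-- Power sums in x and y

X^-swap : ∀ {u} → Alternating u → ∀ g i j → act (X ^ g) u j i ≡ ℤ.- act (Y ^ g) u i j
X^-swap {u} u⁺ zero i j =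
  trans (cong (1ℤ ℤ.*_) (antisym u⁺ i j)) (sym (ℤ.neg-distribʳ-* 1ℤ (u i j)))
X^-swap u⁺ (suc g) i zero    = refl
X^-swap u⁺ (suc g) i (suc j) = X^-swap u⁺ g i j

X^-nonneg : ∀ {u} → Alternating u → ∀ g i j → i ℕ.< j → 0ℤ ℤ.≤ act (X ^ g) u i j
X^-nonneg {u} u⁺ zero i j i<j = subst (0ℤ ℤ.≤_) (sym (ℤ.*-identityˡ (u i j))) (nonneg u⁺ i j i<j)
X^-nonneg u⁺ (suc g) zero    j i<j = ℤ.≤-refl
X^-nonneg u⁺ (suc g) (suc i) j i<j = X^-nonneg u⁺ g i j (ℕ.<-trans (ℕ.n<1+n i) i<j)

Y^-shift : ∀ g u i j → act (Y ^ g) u i (g ℕ.+ j) ≡ u i j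
Y^-shift zero    u i j = ℤ.*-identityˡ (u i j)
Y^-shift (suc g) u i j = Y^-shift g u i j

Y^-out : ∀ g u i j → j ℕ.< g → act (Y ^ g) u i j ≡ 0ℤ
Y^-out (suc g) u i zero    j<g = refl
Y^-out (suc g) u i (suc j) j<g = Y^-out g u i j (ℕ.s<s⁻¹ j<g)

-- Among the lattice paths counted by s ^ (a + b) there is one that takes its
-- b steps in the second coordinate first and so never meets the diagonal.
path-≤ : ∀ {u} → Alternating u → ∀ a b i j → a ℕ.+ i ℕ.< j →
         u i j ℤ.≤ act (s ^ (a ℕ.+ b)) u (a ℕ.+ i) (b ℕ.+ j)
path-≤ {u} u⁺ zero zero i j i<j = ℤ.≤-reflexive (sym (ℤ.*-identityˡ (u i j)))
path-≤ {u} u⁺ zero (suc b) i j i<j =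
  subst (ℤ._≤ act (s ^ suc b) u i (suc b ℕ.+ j)) (ℤ.+-identityˡ (u i j))
    (ℤ.+-mono-≤
      (act-X-nonneg (preserves (s⁺ ^⁺ b) u⁺) i (suc b ℕ.+ j) (ℕ.m≤n⇒m≤o+n (suc b) i<j))
      (path-≤ u⁺ zero b i j i<j))
path-≤ {u} u⁺ (suc a) b i j a+i<j =
  subst (ℤ._≤ act (s ^ (suc a ℕ.+ b)) u (suc a ℕ.+ i) (b ℕ.+ j)) (ℤ.+-identityʳ (u i j))
    (ℤ.+-mono-≤
      (path-≤ u⁺ a b i j (ℕ.<-trans (ℕ.n<1+n _) a+i<j))
      (act-Y-nonneg (preserves (s⁺ ^⁺ (a ℕ.+ b)) u⁺) (suc a ℕ.+ i) (b ℕ.+ j)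
        (ℕ.m≤n⇒m≤o+n b a+i<j)))

-- For k < i the negative entry u i k = - u k i is outweighed by the path from
-- (i , 2 + r + k) to (k , i) counted by p * s ^ r.
reflected-≤ : ∀ {u} → Alternating u → ∀ r i k → k ℕ.< i → i ℕ.< 2 ℕ.+ r ℕ.+ k →
              u k i ℤ.≤ act (p * s ^ r) u i (2 ℕ.+ r ℕ.+ k)
reflected-≤ {u} u⁺ r i k k<i i<j with ℕ.m≤n⇒∃[o]m+o≡n k<i
-- Here i = 1 + k + a and r = a + b. Once `p` has used one step in each coordinate, `a` steps in the
-- first and `b` in the second remain.
... | a , refl with ℕ.m≤n⇒∃[o]m+o≡n (ℕ.+-cancelʳ-≤ k a r
                      (subst (ℕ._≤ r ℕ.+ k) (ℕ.+-comm k a) (ℕ.s≤s⁻¹ (ℕ.s≤s⁻¹ i<j))))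
... | b , refl =
  subst₂ (λ i′ j′ → u k (suc k ℕ.+ a) ℤ.≤ act (s ^ (a ℕ.+ b)) u i′ j′)
    (ℕ.+-comm a k) (rearrange a b k)
    (path-≤ u⁺ a b k (suc k ℕ.+ a) (ℕ.≤-reflexive (cong suc (ℕ.+-comm a k))))
  where
  rearrange : ∀ a b k → b ℕ.+ (suc k ℕ.+ a) ≡ suc (a ℕ.+ b ℕ.+ k)
  rearrange = ℕ-solve-∀

-- For g = 2 + r, x^g + y^g is the difference of Schur polynomials s_(g) - s_(g-1,1) and so not in
-- the cone; `p * s ^ r` supplies the missing s_(g-1,1).
power-sum : ℕ → Op
power-sum r = X ^ (2 ℕ.+ r) + Y ^ (2 ℕ.+ r) + p * s ^ r

power-sum⁺ : ∀ r → Positive (power-sum r)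
power-sum⁺ r .preserves {u} u⁺ = record { antisym = anti ; nonneg = pos }
  where
  g = 2 ℕ.+ r
  v⁺ : Alternating (act (p * s ^ r) u)
  v⁺ = preserves (p⁺ *⁺ s⁺ ^⁺ r) u⁺

  swap : ∀ {a b c a′ b′ c′} → a ≡ ℤ.- a′ → b′ ≡ ℤ.- b → c ≡ ℤ.- c′ →
         a ℤ.+ b ℤ.+ c ≡ ℤ.- (b′ ℤ.+ a′ ℤ.+ c′)
  swap {b = b} {a′ = a′} {c′ = c′} refl refl refl = identity a′ b c′
    where
    identity : ∀ a b c → ℤ.- a ℤ.+ b ℤ.+ ℤ.- c ≡ ℤ.- (ℤ.- b ℤ.+ a ℤ.+ c)
    identity = solve-∀

  anti : ∀ i j → act (power-sum r) u j i ≡ ℤ.- act (power-sum r) u i j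
  anti i j = swap (X^-swap u⁺ g i j) (X^-swap u⁺ g j i) (antisym v⁺ i j)

  outweigh : ∀ {a b c d} → 0ℤ ℤ.≤ a → b ≡ ℤ.- d → d ℤ.≤ c → 0ℤ ℤ.≤ a ℤ.+ b ℤ.+ c
  outweigh {a} {c = c} {d} 0≤a refl d≤c =
    subst (0ℤ ℤ.≤_) (identity a c d) (ℤ.+-mono-≤ 0≤a (ℤ.i≤j⇒0≤j-i d≤c))
    where
    identity : ∀ a c d → a ℤ.+ (c ℤ.- d) ≡ a ℤ.+ ℤ.- d ℤ.+ c
    identity = solve-∀

  pos : ∀ i j → i ℕ.< j → 0ℤ ℤ.≤ act (power-sum r) u i j
  -- Only `Y ^ g` can reach below the diagonal. It contributes 0 if j < g, and otherwise `u i k`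
  -- with k = j - g, which may be negative only if k < i.
  pos i j i<j with g ℕ.≤? j
  ... | no  g≰j = ℤ.+-mono-≤ (ℤ.+-mono-≤ (X^-nonneg u⁺ g i j i<j)
                    (ℤ.≤-reflexive (sym (Y^-out g u i j (ℕ.≰⇒> g≰j))))) (nonneg v⁺ i j i<j)
  ... | yes g≤j with ℕ.m≤n⇒∃[o]m+o≡n g≤j
  ... | k , refl with i ℕ.≤? k
  ... | yes i≤k = ℤ.+-mono-≤ (ℤ.+-mono-≤ (X^-nonneg u⁺ g i (g ℕ.+ k) i<j)
                    (subst (0ℤ ℤ.≤_) (sym (Y^-shift g u i k)) (nonneg-≤ u⁺ i k i≤k)))
                    (nonneg v⁺ i (g ℕ.+ k) i<j)
  ... | no  i≰k = outweigh (X^-nonneg u⁺ g i (g ℕ.+ k) i<j)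
                    (trans (Y^-shift g u i k) (antisym u⁺ k i))
                    (reflected-≤ u⁺ r i k (ℕ.≰⇒> i≰k) i<j)

-- Three legs

h : Op
h = s * s - p

-- This is x² + xy + y², the power sum for g = 2 with its correction term. The factors 1 in the
-- solver equation end the unfolded powers.
h⁺ : Positive h
h⁺ = positive-resp-≈ (solve 2 (λ x y → x :* (x :* con (+ 1)) :+ y :* (y :* con (+ 1)) :+ x :* y :* con (+ 1)
  := (x :+ y) :* (x :+ y) :- x :* y) ≈-refl X Y) (power-sum⁺ 0)

-- With c = e + n, the product p² a₁ a₂ a₃ is the sum of p² a₁ a₂ c₃, p³ a₁ c₂ o₃,
-- p⁴ c₁ o₂ o₃ and p⁵ o₁ o₂ o₃.  The hypothesis deals with the last term, and
-- s² p = h p + p² with the others.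
triple-step : ∀ {e₁ n₁ o₁ e₂ n₂ o₂ e₃ n₃ o₃} →
  Positive e₁ → Positive n₁ → Positive o₁ → Positive e₂ → Positive n₂ → Positive o₂ →
  Positive e₃ → Positive n₃ → Positive o₃ →
  Positive (n₁ * n₂ * n₃ - p * p * (o₁ * o₂ * o₃)) →
  let a₁ = e₁ + n₁ + p * o₁; a₂ = e₂ + n₂ + p * o₂; a₃ = e₃ + n₃ + p * o₃ in
  Positive ((s * a₁ + p * (e₁ + e₁ + n₁)) * (s * a₂ + p * (e₂ + e₂ + n₂)) * (s * a₃ + p * (e₃ + e₃ + n₃))
            - p * p * (a₁ * a₂ * a₃))
triple-step {e₁} {n₁} {o₁} {e₂} {n₂} {o₂} {e₃} {n₃} {o₃} e₁⁺ n₁⁺ o₁⁺ e₂⁺ n₂⁺ o₂⁺ e₃⁺ n₃⁺ o₃⁺ ih =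
  positive-resp-≈
    (solve 11 (λ s p e₁ n₁ o₁ e₂ n₂ o₂ e₃ n₃ o₃ →
      let c₁ = e₁ :+ n₁; c₂ = e₂ :+ n₂; c₃ = e₃ :+ n₃
          a₁ = c₁ :+ p :* o₁; a₂ = c₂ :+ p :* o₂; a₃ = c₃ :+ p :* o₃
          b₁ = e₁ :+ e₁ :+ n₁; b₂ = e₂ :+ e₂ :+ n₂; b₃ = e₃ :+ e₃ :+ n₃ in
        -- In order: the hypothesis; the `h p` share of the terms in `s² p`; their `p²` share minus
        -- the first three pieces of `p² a₁ a₂ a₃`; the terms in `s³` and in `s p²`; the excess of
        -- `b₁ b₂ b₃` over `n₁ n₂ n₃`.
        p :* p :* p :* (n₁ :* n₂ :* n₃ :- p :* p :* (o₁ :* o₂ :* o₃))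
        :+ (s :* s :- p) :* p :* (a₁ :* a₂ :* b₃ :+ a₁ :* b₂ :* a₃ :+ b₁ :* a₂ :* a₃)
        :+ p :* p :* (a₁ :* a₂ :* e₃ :+ a₁ :* (e₂ :* a₃ :+ c₂ :* c₃)
                       :+ e₁ :* a₂ :* a₃ :+ c₁ :* (a₂ :* c₃ :+ c₂ :* (p :* o₃)))
        :+ s :* s :* s :* (a₁ :* a₂ :* a₃)
        :+ s :* p :* p :* (a₁ :* b₂ :* b₃ :+ b₁ :* a₂ :* b₃ :+ b₁ :* b₂ :* a₃)
        :+ p :* p :* p :* ((e₁ :+ e₁) :* b₂ :* b₃ :+ n₁ :* (e₂ :+ e₂) :* b₃ :+ n₁ :* n₂ :* (e₃ :+ e₃))
      := (s :* a₁ :+ p :* b₁) :* (s :* a₂ :+ p :* b₂) :* (s :* a₃ :+ p :* b₃)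
         :- p :* p :* (a₁ :* a₂ :* a₃))
    ≈-refl s p e₁ n₁ o₁ e₂ n₂ o₂ e₃ n₃ o₃)
    ( p⁺ *⁺ p⁺ *⁺ p⁺ *⁺ ih
   +⁺ h⁺ *⁺ p⁺ *⁺ (a₁⁺ *⁺ a₂⁺ *⁺ b₃⁺ +⁺ a₁⁺ *⁺ b₂⁺ *⁺ a₃⁺ +⁺ b₁⁺ *⁺ a₂⁺ *⁺ a₃⁺)
   +⁺ p⁺ *⁺ p⁺ *⁺ (a₁⁺ *⁺ a₂⁺ *⁺ e₃⁺ +⁺ a₁⁺ *⁺ (e₂⁺ *⁺ a₃⁺ +⁺ c₂⁺ *⁺ c₃⁺)
                   +⁺ e₁⁺ *⁺ a₂⁺ *⁺ a₃⁺ +⁺ c₁⁺ *⁺ (a₂⁺ *⁺ c₃⁺ +⁺ c₂⁺ *⁺ (p⁺ *⁺ o₃⁺)))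
   +⁺ s⁺ *⁺ s⁺ *⁺ s⁺ *⁺ (a₁⁺ *⁺ a₂⁺ *⁺ a₃⁺)
   +⁺ s⁺ *⁺ p⁺ *⁺ p⁺ *⁺ (a₁⁺ *⁺ b₂⁺ *⁺ b₃⁺ +⁺ b₁⁺ *⁺ a₂⁺ *⁺ b₃⁺ +⁺ b₁⁺ *⁺ b₂⁺ *⁺ a₃⁺)
   +⁺ p⁺ *⁺ p⁺ *⁺ p⁺ *⁺ ((e₁⁺ +⁺ e₁⁺) *⁺ b₂⁺ *⁺ b₃⁺ +⁺ n₁⁺ *⁺ (e₂⁺ +⁺ e₂⁺) *⁺ b₃⁺
                         +⁺ n₁⁺ *⁺ n₂⁺ *⁺ (e₃⁺ +⁺ e₃⁺)))
  where
  c₁⁺ = e₁⁺ +⁺ n₁⁺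
  c₂⁺ = e₂⁺ +⁺ n₂⁺
  c₃⁺ = e₃⁺ +⁺ n₃⁺
  a₁⁺ = c₁⁺ +⁺ p⁺ *⁺ o₁⁺
  a₂⁺ = c₂⁺ +⁺ p⁺ *⁺ o₂⁺
  a₃⁺ = c₃⁺ +⁺ p⁺ *⁺ o₃⁺
  b₁⁺ = e₁⁺ +⁺ e₁⁺ +⁺ n₁⁺
  b₂⁺ = e₂⁺ +⁺ e₂⁺ +⁺ n₂⁺
  b₃⁺ = e₃⁺ +⁺ e₃⁺ +⁺ n₃⁺

-- A leg with L vertices corresponds to the index L + 1; index 0 comes from the
-- convention P₋₁ = 1.
mutual
  E : ℕ → Op
  E zero          = 0#
  E (suc zero)    = 1#
  E (suc (suc m)) = E (suc m) + N (suc m) + p * E m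

  N : ℕ → Op
  N zero          = 1#
  N (suc zero)    = 0#
  N (suc (suc m)) = s * E (suc m) + p * (E m + E m + N m)

-- The value at 0 continues the recursion of `E` one index further down, so that `E-suc` holds at 0
-- too.
O : ℕ → Op
O zero    = 0#
O (suc m) = E m

mutual
  E⁺ : ∀ m → Positive (E m)
  E⁺ zero          = const⁺ 0
  E⁺ (suc zero)    = const⁺ 1
  E⁺ (suc (suc m)) = E⁺ (suc m) +⁺ N⁺ (suc m) +⁺ p⁺ *⁺ E⁺ m

  N⁺ : ∀ m → Positive (N m)
  N⁺ zero          = const⁺ 1
  N⁺ (suc zero)    = const⁺ 0
  N⁺ (suc (suc m)) = s⁺ *⁺ E⁺ (suc m) +⁺ p⁺ *⁺ (E⁺ m +⁺ E⁺ m +⁺ N⁺ m)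

O⁺ : ∀ m → Positive (O m)
O⁺ zero    = const⁺ 0
O⁺ (suc m) = E⁺ m

-- Brings `O (2 + m)`, which is `E (suc m)`, into the shape of the `a` in `triple-step`.
E-suc : ∀ m → E m + N m + p * O m ≈ E (suc m)
E-suc zero    = solve 1 (λ p → con (+ 0) :+ con (+ 1) :+ p :* con (+ 0) := con (+ 1)) ≈-refl p
E-suc (suc m) = ≈-refl

N-suc-suc : ∀ m → s * (E m + N m + p * O m) + p * (E m + E m + N m) ≈ N (2 ℕ.+ m)
N-suc-suc m = +-congʳ (*-congˡ (E-suc m))

positive-without : ∀ {a b} → Positive a → b ≈ 0# → Positive (a - p * p * b)
positive-without {a} {b} a⁺ b≈0 = positive-resp-≈
  (≈-trans (solve 2 (λ p a → a := a :- p :* p :* con (+ 0)) ≈-refl p a)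
           (+-congˡ (-‿cong (*-congˡ (≈-sym b≈0))))) a⁺

-- All three indices drop by two at once. When one of them reaches 0 or 1, its `O` is 0 and only a
-- product of positive operators remains.
triple : ∀ i j k → Positive (N i * N j * N k - p * p * (O i * O j * O k))
triple (suc (suc i)) (suc (suc j)) (suc (suc k)) =
  positive-resp-≈
    (+-cong (*-cong (*-cong (N-suc-suc i) (N-suc-suc j)) (N-suc-suc k))
            (-‿cong (*-congˡ (*-cong (*-cong (E-suc i) (E-suc j)) (E-suc k)))))
    (triple-step (E⁺ i) (N⁺ i) (O⁺ i) (E⁺ j) (N⁺ j) (O⁺ j) (E⁺ k) (N⁺ k) (O⁺ k) (triple i j k))
triple 0 j k =
  positive-without (N⁺ 0 *⁺ N⁺ j *⁺ N⁺ k)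
    (solve 2 (λ a b → con (+ 0) :* a :* b := con (+ 0)) ≈-refl (O j) (O k))
triple 1 j k =
  positive-without (N⁺ 1 *⁺ N⁺ j *⁺ N⁺ k)
    (solve 2 (λ a b → con (+ 0) :* a :* b := con (+ 0)) ≈-refl (O j) (O k))
triple (suc (suc i)) 0 k =
  positive-without (N⁺ (2 ℕ.+ i) *⁺ N⁺ 0 *⁺ N⁺ k)
    (solve 2 (λ a b → a :* con (+ 0) :* b := con (+ 0)) ≈-refl (O (2 ℕ.+ i)) (O k))
triple (suc (suc i)) 1 k =
  positive-without (N⁺ (2 ℕ.+ i) *⁺ N⁺ 1 *⁺ N⁺ k)
    (solve 2 (λ a b → a :* con (+ 0) :* b := con (+ 0)) ≈-refl (O (2 ℕ.+ i)) (O k))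
triple (suc (suc i)) (suc (suc j)) 0 =
  positive-without (N⁺ (2 ℕ.+ i) *⁺ N⁺ (2 ℕ.+ j) *⁺ N⁺ 0)
    (solve 2 (λ a b → a :* b :* con (+ 0) := con (+ 0)) ≈-refl (O (2 ℕ.+ i)) (O (2 ℕ.+ j)))
triple (suc (suc i)) (suc (suc j)) 1 =
  positive-without (N⁺ (2 ℕ.+ i) *⁺ N⁺ (2 ℕ.+ j) *⁺ N⁺ 1)
    (solve 2 (λ a b → a :* b :* con (+ 0) := con (+ 0)) ≈-refl (O (2 ℕ.+ i)) (O (2 ℕ.+ j)))

-- `path z (suc k)` is the independence polynomial of the path with `k` vertices, with the index
-- shift of `E` and `N`.
path : Op → ℕ → Op
path z zero          = 1#
path z (suc zero)    = 1#
path z (suc (suc m)) = path z (suc m) + z * path z m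

mutual
  -- Expanding both factors yields the diagonal product and both mixed products at lower indices,
  -- hence the joint induction. Three copies of `p * E m` arise: one goes into `E (2 + m)`, as the
  -- mixed products demand, and two into `N (2 + m)`.
  path-diagonal : ∀ m → path X m * path Y m ≈ E m + N m
  path-diagonal zero          = solve 0 (con (+ 1) :* con (+ 1) := con (+ 0) :+ con (+ 1)) ≈-refl
  path-diagonal (suc zero)    = solve 0 (con (+ 1) :* con (+ 1) := con (+ 1) :+ con (+ 0)) ≈-refl
  path-diagonal (suc (suc m)) = ≈-trans
    (solve 6 (λ x y a a′ b b′ → (a :+ x :* b) :* (a′ :+ y :* b′)
      := a :* a′ :+ y :* (b′ :* a) :+ x :* (b :* a′) :+ x :* y :* (b :* b′)) ≈-refl
      X Y (path X (suc m)) (path Y (suc m)) (path X m) (path Y m))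
    (≈-trans
      (+-cong (+-cong (+-cong (path-diagonal (suc m))
        (*-congˡ (≈-trans (*-comm (path Y m) (path X (suc m))) (path-lowerʸ m))))
        (*-congˡ (path-lowerˣ m))) (*-congˡ (path-diagonal m)))
      (solve 6 (λ x y E N E′ N′ →
          E :+ N :+ y :* (E :+ x :* E′) :+ x :* (E :+ y :* E′) :+ x :* y :* (E′ :+ N′)
          := E :+ N :+ x :* y :* E′ :+ ((x :+ y) :* E :+ x :* y :* (E′ :+ E′ :+ N′))) ≈-refl
        X Y (E (suc m)) (N (suc m)) (E m) (N m)))

  path-lowerˣ : ∀ m → path X m * path Y (suc m) ≈ E (suc m) + Y * E m
  path-lowerˣ zero    = solve 1 (λ y → con (+ 1) :* con (+ 1) := con (+ 1) :+ y :* con (+ 0)) ≈-refl Y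
  path-lowerˣ (suc m) = ≈-trans
    (solve 4 (λ y a a′ b′ → a :* (a′ :+ y :* b′) := a :* a′ :+ y :* (a :* b′)) ≈-refl
      Y (path X (suc m)) (path Y (suc m)) (path Y m))
    (≈-trans
      (+-cong (path-diagonal (suc m)) (*-congˡ (path-lowerʸ m)))
      (solve 5 (λ x y E N E′ → E :+ N :+ y :* (E :+ x :* E′) := E :+ N :+ x :* y :* E′ :+ y :* E) ≈-refl
        X Y (E (suc m)) (N (suc m)) (E m)))

  path-lowerʸ : ∀ m → path X (suc m) * path Y m ≈ E (suc m) + X * E m
  path-lowerʸ zero    = solve 1 (λ x → con (+ 1) :* con (+ 1) := con (+ 1) :+ x :* con (+ 0)) ≈-refl X
  path-lowerʸ (suc m) = ≈-trans
    (solve 4 (λ x a a′ b → (a :+ x :* b) :* a′ := a :* a′ :+ x :* (b :* a′)) ≈-refl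
      X (path X (suc m)) (path Y (suc m)) (path X m))
    (≈-trans
      (+-cong (path-diagonal (suc m)) (*-congˡ (path-lowerˣ m)))
      (solve 5 (λ x y E N E′ → E :+ N :+ x :* (E :+ y :* E′) := E :+ N :+ x :* y :* E′ :+ x :* E) ≈-refl
        X Y (E (suc m)) (N (suc m)) (E m)))

-- Any number of legs

∏ : (ℕ → Op) → List ℕ → Op
∏ f = foldr (λ k a → f k * a) 1#

∏-* : ∀ {f g f∙g} → (∀ k → f k * g k ≈ f∙g k) → ∀ ks → ∏ f ks * ∏ g ks ≈ ∏ f∙g ks
∏-* f*g []       = solve 0 (con 1ℤ :* con 1ℤ := con 1ℤ) ≈-refl
∏-* {f} {g} f*g (k ∷ ks) = ≈-trans
  (solve 4 (λ a b c d → a :* b :* (c :* d) := a :* c :* (b :* d)) ≈-refl (f k) (∏ f ks) (g k) (∏ g ks))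
  (*-cong (f*g k) (∏-* f*g ks))

∏⁺ : ∀ {f} → (∀ k → Positive (f k)) → ∀ ks → Positive (∏ f ks)
∏⁺ f⁺ []       = const⁺ 1
∏⁺ f⁺ (k ∷ ks) = f⁺ k *⁺ ∏⁺ f⁺ ks

paths shortened : Op → List ℕ → Op
paths z     = ∏ (λ k → path z (suc k))
shortened z = ∏ (path z)

both : List ℕ → Op
both = ∏ (λ k → E (suc k) + N (suc k))

-- `mixed X ks` equals `paths X ks * shortened Y ks`, and `mixed Y ks` equals
-- `shortened X ks * paths Y ks`: the argument names the variable in which the legs are whole.
mixed : Op → List ℕ → Op
mixed z = ∏ (λ k → E (suc k) + z * E k)

both⁺ : ∀ ks → Positive (both ks)
both⁺ = ∏⁺ (λ k → E⁺ (suc k) +⁺ N⁺ (suc k))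

-- Lets `N` of a leg pay for the extra factor `s` that arises when the leg contributes `O` in
-- `mixed-powers⁺`.
N-gap⁺ : ∀ k → Positive (N (suc k) - s * E k)
N-gap⁺ zero    = positive-resp-≈
  (solve 1 (λ s → con (+ 0) := con (+ 0) :- s :* con (+ 0)) ≈-refl s) (const⁺ 0)
N-gap⁺ (suc k) = positive-resp-≈
  (solve 2 (λ a b → b := a :+ b :- a) ≈-refl (s * E (suc k)) (p * (E k + E k + N k)))
  (p⁺ *⁺ (E⁺ k +⁺ E⁺ k +⁺ N⁺ k))

-- The exponent is general because a leg contributing `E` keeps `r` while one contributing `O`
-- raises it by one. The empty list is `power-sum⁺`.
mixed-powers⁺ : ∀ r ks →
  Positive (X ^ (2 ℕ.+ r) * mixed X ks + Y ^ (2 ℕ.+ r) * mixed Y ks + p * s ^ r * both ks)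
mixed-powers⁺ r [] = positive-resp-≈
  (solve 3 (λ a b c → a :+ b :+ c := a :* con 1ℤ :+ b :* con 1ℤ :+ c :* con 1ℤ) ≈-refl
    (X ^ (2 ℕ.+ r)) (Y ^ (2 ℕ.+ r)) (p * s ^ r))
  (power-sum⁺ r)
mixed-powers⁺ r (k ∷ ks) = positive-resp-≈
  (solve 13 (λ x y xʳ yʳ sʳ s p φx φy m E O N →
      E :* (xʳ :* φx :+ yʳ :* φy :+ p :* sʳ :* m)
      :+ O :* (x :* xʳ :* φx :+ y :* yʳ :* φy :+ p :* (s :* sʳ) :* m)
      :+ p :* sʳ :* m :* (N :- s :* O)
      := xʳ :* ((E :+ x :* O) :* φx) :+ yʳ :* ((E :+ y :* O) :* φy) :+ p :* sʳ :* ((E :+ N) :* m))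
    ≈-refl X Y (X ^ (2 ℕ.+ r)) (Y ^ (2 ℕ.+ r)) (s ^ r) s p (mixed X ks) (mixed Y ks) (both ks)
    (E (suc k)) (E k) (N (suc k)))
  ( E⁺ (suc k) *⁺ mixed-powers⁺ r ks
 +⁺ E⁺ k *⁺ mixed-powers⁺ (suc r) ks
 +⁺ p⁺ *⁺ s⁺ ^⁺ r *⁺ both⁺ ks *⁺ N-gap⁺ k)

-- State after two legs have contributed `O`, or `N` on the side of `both`. A third `O` produces x²
-- and y², so `mixed-powers⁺ 0` applies at the cost of `p * p` times three factors `O`; `triple`
-- pays for it.
two-legs⁺ : ∀ a b ks →
  Positive (p * (E a * E b) * (X * mixed X ks + Y * mixed Y ks) + N (suc a) * N (suc b) * both ks)
two-legs⁺ a b [] = positive-resp-≈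
  (solve 5 (λ x y p O N → p :* O :* (x :+ y) :+ N
      := p :* O :* (x :* con 1ℤ :+ y :* con 1ℤ) :+ N :* con 1ℤ)
    ≈-refl X Y p (E a * E b) (N (suc a) * N (suc b)))
  (p⁺ *⁺ (E⁺ a *⁺ E⁺ b) *⁺ s⁺ +⁺ N⁺ (suc a) *⁺ N⁺ (suc b))
two-legs⁺ a b (k ∷ ks) = positive-resp-≈
  (solve 11 (λ x y p φx φy m E O N OO NN →
      E :* (p :* OO :* (x :* φx :+ y :* φy) :+ NN :* m)
      :+ p :* (OO :* O) :* (x :* (x :* con 1ℤ) :* φx :+ y :* (y :* con 1ℤ) :* φy :+ p :* con 1ℤ :* m)
      :+ (NN :* N :- p :* p :* (OO :* O)) :* m
      := p :* OO :* (x :* ((E :+ x :* O) :* φx) :+ y :* ((E :+ y :* O) :* φy)) :+ NN :* ((E :+ N) :* m))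
    ≈-refl X Y p (mixed X ks) (mixed Y ks) (both ks) (E (suc k)) (E k) (N (suc k))
    (E a * E b) (N (suc a) * N (suc b)))
  ( E⁺ (suc k) *⁺ two-legs⁺ a b ks
 +⁺ p⁺ *⁺ (E⁺ a *⁺ E⁺ b *⁺ E⁺ k) *⁺ mixed-powers⁺ 0 ks
 +⁺ triple (suc a) (suc b) (suc k) *⁺ both⁺ ks)

-- State after one leg has contributed `O` or `N`: the next leg either contributes `E` and keeps the
-- state, or leads to `two-legs⁺`.
one-leg⁺ : ∀ a ks → Positive (p * E a * (mixed X ks + mixed Y ks) + N (suc a) * both ks)
one-leg⁺ a [] = positive-resp-≈
  (solve 3 (λ p O N → p :* O :* con (+ 2) :+ N := p :* O :* (con 1ℤ :+ con 1ℤ) :+ N :* con 1ℤ)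
    ≈-refl p (E a) (N (suc a)))
  (p⁺ *⁺ E⁺ a *⁺ const⁺ 2 +⁺ N⁺ (suc a))
one-leg⁺ a (k ∷ ks) = positive-resp-≈
  (solve 11 (λ x y p φx φy m E O N O′ N′ →
      E :* (p :* O′ :* (φx :+ φy) :+ N′ :* m)
      :+ (p :* (O′ :* O) :* (x :* φx :+ y :* φy) :+ N′ :* N :* m)
      := p :* O′ :* ((E :+ x :* O) :* φx :+ (E :+ y :* O) :* φy) :+ N′ :* ((E :+ N) :* m))
    ≈-refl X Y p (mixed X ks) (mixed Y ks) (both ks) (E (suc k)) (E k) (N (suc k)) (E a) (N (suc a)))
  (E⁺ (suc k) *⁺ one-leg⁺ a ks +⁺ two-legs⁺ a k ks)

-- The products are expanded one leg at a time, starting with no `O` taken. The first `O` turns both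
-- `Y * X` and `X * Y` into `p`, which gives `one-leg⁺`.
torso⁺ : ∀ ks → Positive (Y * mixed X ks + X * mixed Y ks + both ks)
torso⁺ [] = positive-resp-≈
  (solve 2 (λ x y → x :+ y :+ con 1ℤ := y :* con 1ℤ :+ x :* con 1ℤ :+ con 1ℤ) ≈-refl X Y)
  (s⁺ +⁺ const⁺ 1)
torso⁺ (k ∷ ks) = positive-resp-≈
  (solve 8 (λ x y φx φy m E O N →
      E :* (y :* φx :+ x :* φy :+ m) :+ (x :* y :* O :* (φx :+ φy) :+ N :* m)
      := y :* ((E :+ x :* O) :* φx) :+ x :* ((E :+ y :* O) :* φy) :+ (E :+ N) :* m)
    ≈-refl X Y (mixed X ks) (mixed Y ks) (both ks) (E (suc k)) (E k) (N (suc k)))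
  (E⁺ (suc k) *⁺ torso⁺ ks +⁺ one-leg⁺ k ks)

-- `ν` stands for n - 1, the number of vertices of the complete graph besides the torso.
pineapplePolynomial : ℕ → List ℕ → Op → Op
pineapplePolynomial ν ks z = (1# + const (+ ν) * z) * paths z ks + z * shortened z ks

const-suc : ∀ k → 1# + const (+ k) ≈ const (+ suc k)
const-suc k = pointwise λ u i j → sym (ℤ.*-distribʳ-+ (u i j) 1ℤ (+ k))

-- (1 + νx)(1 + νy) provides ν s + ν² p beyond 1. Of this `one-leg⁺ 1` takes ν (s + p), which leaves
-- ν² - ν times `p`.
ν²-ν⁺ : ∀ ν → Positive (const (+ ν) * const (+ ν) - const (+ ν))
ν²-ν⁺ zero    = positive-resp-≈
  (solve 0 (con (+ 0) := con (+ 0) :* con (+ 0) :- con (+ 0)) ≈-refl) (const⁺ 0)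
ν²-ν⁺ (suc k) = positive-resp-≈
  (≈-trans
    (solve 1 (λ k → (con 1ℤ :+ k) :* k := (con 1ℤ :+ k) :* (con 1ℤ :+ k) :- (con 1ℤ :+ k)) ≈-refl (const (+ k)))
    (+-cong (*-cong (const-suc k) (const-suc k)) (-‿cong (const-suc k))))
  ((const⁺ 1 +⁺ const⁺ k) *⁺ const⁺ k)

-- The part that is linear in ν is one-leg⁺ for a leg with a single vertex, for which
-- E 1 = 1 and N 2 = s + p.
pineapplePolynomial⁺ : ∀ ν ks → Positive (pineapplePolynomial ν ks X * pineapplePolynomial ν ks Y)
pineapplePolynomial⁺ ν ks = positive-resp-≈
  (≈-trans
    (solve 7 (λ x y ν φx φy m d →
        y :* φx :+ x :* φy :+ m
        :+ ν :* (x :* y :* con 1ℤ :* (φx :+ φy)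
                 :+ ((x :+ y) :* con 1ℤ :+ x :* y :* (con (+ 0) :+ con (+ 0) :+ con 1ℤ)) :* m)
        :+ (ν :* ν :- ν) :* (x :* y) :* m
        :+ x :* y :* d
        := (con 1ℤ :+ ν :* x) :* (con 1ℤ :+ ν :* y) :* m :+ (con 1ℤ :+ ν :* x) :* y :* φx
           :+ (con 1ℤ :+ ν :* y) :* x :* φy :+ x :* y :* d)
      ≈-refl X Y (const (+ ν)) (mixed X ks) (mixed Y ks) (both ks) (shortened X ks * shortened Y ks))
    (≈-trans
      (+-congʳ (+-cong (+-cong
        (*-congˡ (≈-sym (∏-* (λ k → path-diagonal (suc k)) ks)))
        (*-congˡ (≈-sym (∏-* path-lowerʸ ks))))
        (*-congˡ (≈-sym (∏-* path-lowerˣ ks)))))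
      (solve 7 (λ x y ν ax ay bx by →
          (con 1ℤ :+ ν :* x) :* (con 1ℤ :+ ν :* y) :* (ax :* ay) :+ (con 1ℤ :+ ν :* x) :* y :* (ax :* by)
          :+ (con 1ℤ :+ ν :* y) :* x :* (bx :* ay) :+ x :* y :* (bx :* by)
          := ((con 1ℤ :+ ν :* x) :* ax :+ x :* bx) :* ((con 1ℤ :+ ν :* y) :* ay :+ y :* by))
        ≈-refl X Y (const (+ ν)) (paths X ks) (paths Y ks) (shortened X ks) (shortened Y ks))))
  ( torso⁺ ks
 +⁺ const⁺ ν *⁺ one-leg⁺ 1 ks
 +⁺ ν²-ν⁺ ν *⁺ p⁺ *⁺ both⁺ ks
 +⁺ p⁺ *⁺ positive-resp-≈ (≈-sym (∏-* path-diagonal ks)) (∏⁺ (λ k → E⁺ k +⁺ N⁺ k) ks))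

-- Independence polynomials of lists of vertices

filter-map : ∀ {A B : Set} {P : Pred B 0ℓ} (P? : Unary.Decidable P) (f : A → B) xs →
             filter P? (map f xs) ≡ map f (filter (P? ∘ f) xs)
filter-map P? f []       = refl
filter-map P? f (x ∷ xs) with P? (f x)
... | yes _ = cong (f x ∷_) (filter-map P? f xs)
... | no  _ = filter-map P? f xs

filter-filter : ∀ {A : Set} {P Q R : Pred A 0ℓ}
                (P? : Unary.Decidable P) (Q? : Unary.Decidable Q) (R? : Unary.Decidable R) →
                (∀ {x} → R x → P x × Q x) → (∀ {x} → P x → Q x → R x) →
                ∀ xs → filter R? xs ≡ filter P? (filter Q? xs)
filter-filter P? Q? R? to from [] = refl
filter-filter P? Q? R? to from (x ∷ xs) with Q? x
... | no ¬q = trans (filter-reject R? (¬q ∘ proj₂ ∘ to)) (filter-filter P? Q? R? to from xs)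
... | yes q with P? x
...   | no ¬p = trans (filter-reject R? (¬p ∘ proj₁ ∘ to)) (filter-filter P? Q? R? to from xs)
...   | yes p = trans (filter-accept R? (from p q)) (cong (x ∷_) (filter-filter P? Q? R? to from xs))

sublists-map : ∀ {A B : Set} (f : A → B) xs → sublists (map f xs) ≡ map (map f) (sublists xs)
sublists-map f []       = refl
sublists-map f (x ∷ xs) rewrite sublists-map f xs =
  trans (cong (map (map f) (sublists xs) ++_)
            (trans (sym (map-∘ (sublists xs))) (map-∘ (sublists xs))))
          (sym (map-++ (map f) (sublists xs) (map (x ∷_) (sublists xs))))

filter-sublists : ∀ {A : Set} {Q : Pred A 0ℓ} (Q? : Unary.Decidable Q) xs →
                  filter (all? Q?) (sublists xs) ≡ sublists (filter Q? xs)
filter-sublists Q? []       = refl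
filter-sublists Q? (x ∷ xs) with Q? x
... | yes q = trans (filter-++ (all? Q?) (sublists xs) _)
  (cong₂ _++_ (filter-sublists Q? xs)
    (trans (filter-map (all? Q?) (x ∷_) (sublists xs))
      (cong (map (x ∷_)) (trans
        (filter-≐ (all? Q? ∘ (x ∷_)) (all? Q?) ((λ { (_ ∷ qs) → qs }) , (q ∷_)) (sublists xs))
        (filter-sublists Q? xs)))))
... | no ¬q = trans (filter-++ (all? Q?) (sublists xs) _)
  (trans (cong₂ _++_ (filter-sublists Q? xs)
    (filter-none (all? Q?) (All.map⁺ (All.universal (λ { _ (q ∷ _) → ¬q q }) (sublists xs)))))
    (++-identityʳ _))

weight : {V : Set} → Op → List (List V) → Op
weight z = foldr (λ S a → z ^ length S + a) 0#

weight-++ : ∀ {V : Set} z (Ss Ts : List (List V)) → weight z (Ss ++ Ts) ≈ weight z Ss + weight z Ts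
weight-++ z []       Ts = ≈-sym (+-identityˡ (weight z Ts))
weight-++ z (S ∷ Ss) Ts =
  ≈-trans (+-congˡ (weight-++ z Ss Ts)) (≈-sym (+-assoc (z ^ length S) (weight z Ss) (weight z Ts)))

weight-∷ : ∀ {V : Set} z (v : V) Ss → weight z (map (v ∷_) Ss) ≈ z * weight z Ss
weight-∷ z v []       = solve 1 (λ z → con 0ℤ := z :* con 0ℤ) ≈-refl z
weight-∷ z v (S ∷ Ss) = ≈-trans (+-congˡ (weight-∷ z v Ss))
  (solve 3 (λ z a b → z :* a :+ z :* b := z :* (a :+ b)) ≈-refl z (z ^ length S) (weight z Ss))

weight-map : ∀ {V W : Set} z (f : W → V) Ss → weight z (map (map f) Ss) ≡ weight z Ss
weight-map z f []       = refl
weight-map z f (S ∷ Ss) = cong₂ (λ l a → z ^ l + a) (length-map f S) (weight-map z f Ss)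

module _ {V : Set} {R : Rel V 0ℓ} (R? : Decidable R) where

  stable? : Unary.Decidable (AllPairs (λ u v → ¬ R u v))
  stable? = allPairs? (λ u v → ¬? (R? u v))

  independence : Op → List V → Op
  independence z vs = weight z (filter stable? (sublists vs))

  nonadjacent? : ∀ v → Unary.Decidable (∁ (R v))
  nonadjacent? v = ¬? ∘ R? v

  -- The deletion recurrence I(G) = I(G - v) + z I(G - N[v]), split by whether a set contains `v`.
  independence-∷ : ∀ z v vs → independence z (v ∷ vs) ≈
                   independence z vs + z * independence z (filter (nonadjacent? v) vs)
  independence-∷ z v vs = begin
    weight z (filter stable? (sublists vs ++ map (v ∷_) (sublists vs)))
      ≡⟨ cong (weight z) (filter-++ stable? (sublists vs) _) ⟩
    weight z (filter stable? (sublists vs) ++ filter stable? (map (v ∷_) (sublists vs)))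
      ≈⟨ weight-++ z (filter stable? (sublists vs)) _ ⟩
    independence z vs + weight z (filter stable? (map (v ∷_) (sublists vs)))
      ≡⟨ cong (λ Ss → independence z vs + weight z Ss) with-v ⟩
    independence z vs + weight z (map (v ∷_) (filter stable? (sublists (filter (nonadjacent? v) vs))))
      ≈⟨ +-congˡ (weight-∷ z v (filter stable? (sublists (filter (nonadjacent? v) vs)))) ⟩
    independence z vs + z * independence z (filter (nonadjacent? v) vs) ∎
    where
    with-v : filter stable? (map (v ∷_) (sublists vs)) ≡
             map (v ∷_) (filter stable? (sublists (filter (nonadjacent? v) vs)))
    with-v = trans (filter-map stable? (v ∷_) (sublists vs)) (cong (map (v ∷_)) (trans
      (filter-filter stable? (all? (nonadjacent? v)) (stable? ∘ (v ∷_))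
        (λ { (a ∷ i) → i , a }) (λ i a → a ∷ i) (sublists vs))
      (cong (filter stable?) (filter-sublists (nonadjacent? v) vs))))

  independence-[] : ∀ z → independence z [] ≈ 1#
  independence-[] z = +-identityʳ 1#

  Separated : List V → List V → Set
  Separated us vs = All (λ u → All (∁ (R u)) vs) us

  independence-++ : ∀ z us vs → Separated us vs →
                    independence z (us ++ vs) ≈ independence z us * independence z vs
  independence-++ z us vs = bounded (length us) us ℕ.≤-refl
    where
    -- One recursive call is on a filtered list, which is not structurally smaller; the length bound
    -- makes the recursion terminate.
    bounded : ∀ b us → length us ℕ.≤ b → Separated us vs →
              independence z (us ++ vs) ≈ independence z us * independence z vs
    bounded b [] _ _ =
      solve 1 (λ a → a := (con 1ℤ :+ con 0ℤ) :* a) ≈-refl (independence z vs)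
    bounded (suc b) (u ∷ us) (s≤s us≤b) (u-vs ∷ us-vs) = begin
      independence z (u ∷ us ++ vs)
        ≈⟨ independence-∷ z u (us ++ vs) ⟩
      independence z (us ++ vs) + z * independence z (filter (nonadjacent? u) (us ++ vs))
        ≡⟨ cong (λ ws → independence z (us ++ vs) + z * independence z ws)
             (trans (filter-++ (nonadjacent? u) us vs)
               (cong (us′ ++_) (filter-all (nonadjacent? u) u-vs))) ⟩
      independence z (us ++ vs) + z * independence z (us′ ++ vs)
        ≈⟨ +-cong (bounded b us us≤b us-vs)
             (*-congˡ (bounded b us′ (ℕ.≤-trans (length-filter (nonadjacent? u) us) us≤b)
               (All.filter⁺ (nonadjacent? u) us-vs))) ⟩
      independence z us * independence z vs + z * (independence z us′ * independence z vs)
        ≈⟨ solve 4 (λ z a a′ b → a :* b :+ z :* (a′ :* b) := (a :+ z :* a′) :* b) ≈-refl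
             z (independence z us) (independence z us′) (independence z vs) ⟩
      (independence z us + z * independence z us′) * independence z vs
        ≈⟨ *-congʳ (≈-sym (independence-∷ z u us)) ⟩
      independence z (u ∷ us) * independence z vs ∎
      where us′ = filter (nonadjacent? u) us

independence-map : ∀ {V W : Set} {R : Rel V 0ℓ} {R′ : Rel W 0ℓ} (R? : Decidable R) (R′? : Decidable R′)
                   (f : W → V) → (∀ {u v} → R (f u) (f v) → R′ u v) → (∀ {u v} → R′ u v → R (f u) (f v)) →
                   ∀ z ws → independence R? z (map f ws) ≡ independence R′? z ws
independence-map R? R′? f to from z ws =
  trans (cong (weight z)
    (trans (cong (filter (stable? R?)) (sublists-map f ws))
    (trans (filter-map (stable? R?) (map f) (sublists ws))
      (cong (map (map f)) (filter-≐ (stable? R? ∘ map f) (stable? R′?)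
        ( (λ i → AllPairs.map (_∘ from) (AllPairs.map⁻ i))
        , (λ i → AllPairs.map⁺ (AllPairs.map (_∘ to) i)))
        (sublists ws))))))
    (weight-map z f (filter (stable? R′?) (sublists ws)))
  where import Data.List.Relation.Unary.AllPairs as AllPairs using (map)

-- Spiders and pineapple graphs

PathEdge : ∀ {k} → Rel (Fin k) 0ℓ
PathEdge i j = toℕ j ≡ suc (toℕ i) ⊎ toℕ i ≡ suc (toℕ j)

pathEdge? : ∀ {k} → Decidable (PathEdge {k})
pathEdge? i j = (toℕ j ℕ.≟ suc (toℕ i)) ⊎-dec (toℕ i ℕ.≟ suc (toℕ j))

allFin-suc : ∀ k → allFin (suc k) ≡ zero ∷ map suc (allFin k)
allFin-suc k = cong (zero ∷_) (sym (map-tabulate id suc))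

independence-path-suc : ∀ {k} z (is : List (Fin k)) →
                        independence pathEdge? z (map suc is) ≡ independence pathEdge? z is
independence-path-suc = independence-map pathEdge? pathEdge? suc
  (Sum.map ℕ.suc-injective ℕ.suc-injective) (Sum.map (cong suc) (cong suc))

independence-path : ∀ k z → independence pathEdge? z (allFin k) ≈ path z (suc k)
independence-path zero z = independence-[] (pathEdge? {0}) z
independence-path (suc k) z = begin
  independence pathEdge? z (allFin (suc k))
    ≡⟨ cong (independence pathEdge? z) (allFin-suc k) ⟩
  independence pathEdge? z (zero ∷ map suc (allFin k))
    ≈⟨ independence-∷ pathEdge? z zero (map suc (allFin k)) ⟩
  independence pathEdge? z (map suc (allFin k))
  + z * independence pathEdge? z (filter (nonadjacent? pathEdge? zero) (map suc (allFin k)))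
    ≈⟨ +-cong (≈-trans (reflexive (independence-path-suc z (allFin k))) (independence-path k z))
              (*-congˡ (beyond-neighbour k)) ⟩
  path z (suc k) + z * path z k ∎
  where
  beyond-neighbour : ∀ k → independence pathEdge? z
    (filter (nonadjacent? pathEdge? (zero {k})) (map suc (allFin k))) ≈ path z k
  -- A lone vertex has no neighbour to delete; the convention `path z 0 = 1` gives the right value.
  beyond-neighbour zero    = independence-[] (pathEdge? {1}) z
  beyond-neighbour (suc k) = begin
    independence pathEdge? z (filter (nonadjacent? pathEdge? zero) (map suc (allFin (suc k))))
      ≡⟨ cong (λ is → independence pathEdge? z (filter (nonadjacent? pathEdge? zero) (map suc is)))
           (allFin-suc k) ⟩
    independence pathEdge? z (filter (nonadjacent? pathEdge? zero) (suc zero ∷ map suc (map suc (allFin k))))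
      ≡⟨ cong (independence pathEdge? z) (trans
           (filter-reject (nonadjacent? pathEdge? zero) {xs = map suc (map suc (allFin k))}
             (λ nonadj → nonadj (inj₁ refl)))
           (filter-all (nonadjacent? pathEdge? zero) {xs = map suc (map suc (allFin k))}
             (All.map⁺ (All.map⁺ (All.universal (λ _ → λ { (inj₁ ()) ; (inj₂ ()) }) (allFin k)))))) ⟩
    independence pathEdge? z (map suc (map suc (allFin k)))
      ≡⟨ trans (independence-path-suc z (map suc (allFin k))) (independence-path-suc z (allFin k)) ⟩
    independence pathEdge? z (allFin k)
      ≈⟨ independence-path k z ⟩
    path z (suc k) ∎

LegEdge : ∀ ks → Rel (LegVertex ks) 0ℓ
LegEdge ks v w = SpiderEdge ks (just v) (just w) ⊎ SpiderEdge ks (just w) (just v)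

legEdge? : ∀ ks → Decidable (LegEdge ks)
legEdge? ks v w = spiderEdge? ks (just v) (just w) ⊎-dec spiderEdge? ks (just w) (just v)

-- No edge joins two legs. Arbitrary lists of leg vertices are allowed, so that whole and shortened
-- legs are both covered.
independence-legs-∷ : ∀ k ks z (is : List (Fin k)) vs →
  independence (legEdge? (k ∷ ks)) z (map (zero ,_) is ++ map (legVertex-suc k ks) vs) ≈
  independence pathEdge? z is * independence (legEdge? ks) z vs
independence-legs-∷ k ks z is vs = ≈-trans
  (independence-++ (legEdge? (k ∷ ks)) z (map (zero ,_) is) (map (legVertex-suc k ks) vs)
    (All.map⁺ (All.universal (λ _ → All.map⁺ (All.universal
      (λ _ → λ { (inj₁ ()) ; (inj₂ ()) }) vs)) is)))
  (reflexive (cong₂ _*_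
    (independence-map (legEdge? (k ∷ ks)) pathEdge? (zero ,_)
      (Sum.map proj₂ proj₂) (Sum.map (refl ,_) (refl ,_)) z is)
    (independence-map (legEdge? (k ∷ ks)) (legEdge? ks) (legVertex-suc k ks)
      (Sum.map pred pred) (Sum.map succ succ) z vs)))
  where
  pred : ∀ {v w} → SpiderEdge (k ∷ ks) (just (legVertex-suc k ks v)) (just (legVertex-suc k ks w)) →
         SpiderEdge ks (just v) (just w)
  pred (i≡i′ , adj) = Fin.suc-injective i≡i′ , adj
  succ : ∀ {v w} → SpiderEdge ks (just v) (just w) →
         SpiderEdge (k ∷ ks) (just (legVertex-suc k ks v)) (just (legVertex-suc k ks w))
  succ (i≡i′ , adj) = cong suc i≡i′ , adj

independence-legs : ∀ ks z → independence (legEdge? ks) z (legVertices ks) ≈ paths z ks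
independence-legs []       z = independence-[] (legEdge? []) z
independence-legs (k ∷ ks) z = ≈-trans (independence-legs-∷ k ks z (allFin k) (legVertices ks))
  (*-cong (independence-path k z) (independence-legs ks z))

beyondFirst? : ∀ ks → Unary.Decidable {A = LegVertex ks} (λ v → toℕ (proj₂ v) ≢ 0)
beyondFirst? ks v = ¬? (toℕ (proj₂ v) ℕ.≟ 0)

nonzero? : ∀ {k} → Unary.Decidable {A = Fin k} (λ j → toℕ j ≢ 0)
nonzero? j = ¬? (toℕ j ℕ.≟ 0)

independence-path-nonzero : ∀ k z → independence pathEdge? z (filter nonzero? (allFin k)) ≈ path z k
independence-path-nonzero zero    z = independence-[] (pathEdge? {0}) z
independence-path-nonzero (suc k) z = ≈-trans
  (reflexive (trans
    (cong (independence pathEdge? z) (trans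
      (cong (filter nonzero?) (allFin-suc k))
      (filter-all nonzero? (All.map⁺ (All.universal (λ _ ()) (allFin k))))))
    (independence-path-suc z (allFin k))))
  (independence-path k z)

independence-legs-beyondFirst : ∀ ks z →
  independence (legEdge? ks) z (filter (beyondFirst? ks) (legVertices ks)) ≈ shortened z ks
independence-legs-beyondFirst []       z = independence-[] (legEdge? []) z
independence-legs-beyondFirst (k ∷ ks) z = begin
  independence (legEdge? (k ∷ ks)) z (filter (beyondFirst? (k ∷ ks)) (legVertices (k ∷ ks)))
    ≡⟨ cong (independence (legEdge? (k ∷ ks)) z) (trans
         (filter-++ (beyondFirst? (k ∷ ks)) (map (zero ,_) (allFin k)) _)
         (cong₂ _++_ (filter-map (beyondFirst? (k ∷ ks)) (zero ,_) (allFin k))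
                     (filter-map (beyondFirst? (k ∷ ks)) (legVertex-suc k ks) (legVertices ks)))) ⟩
  independence (legEdge? (k ∷ ks)) z (map (zero ,_) (filter nonzero? (allFin k))
    ++ map (legVertex-suc k ks) (filter (beyondFirst? ks) (legVertices ks)))
    ≈⟨ independence-legs-∷ k ks z (filter nonzero? (allFin k)) _ ⟩
  independence pathEdge? z (filter nonzero? (allFin k))
  * independence (legEdge? ks) z (filter (beyondFirst? ks) (legVertices ks))
    ≈⟨ *-cong (independence-path-nonzero k z) (independence-legs-beyondFirst ks z) ⟩
  path z k * shortened z ks ∎

-- Choosing `u` excludes every other vertex. Sublists are allowed because the clique is needed
-- without the torso.
independence-complete : ∀ {k} z (us : List (Fin k)) → Unique us →
  independence (Graph.adj? (completeGraph k)) z us ≈ 1# + const (+ length us) * z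
independence-complete {k} z [] [] =
  solve 1 (λ z → con 1ℤ :+ con 0ℤ := con 1ℤ :+ con 0ℤ :* z) ≈-refl z
independence-complete {k} z (u ∷ us) (u∉us ∷ us!) = begin
  independence adj? z (u ∷ us)
    ≈⟨ independence-∷ adj? z u us ⟩
  independence adj? z us + z * independence adj? z (filter (nonadjacent? adj? u) us)
    ≡⟨ cong (λ vs → independence adj? z us + z * independence adj? z vs)
         (filter-none (nonadjacent? adj? u) (All.map (λ u≢v nonadj → nonadj u≢v) u∉us)) ⟩
  independence adj? z us + z * independence adj? z []
    ≈⟨ +-cong (independence-complete z us us!) (*-congˡ (independence-[] adj? z)) ⟩
  1# + const (+ length us) * z + z * 1#
    ≈⟨ solve 2 (λ z c → con 1ℤ :+ c :* z :+ z :* con 1ℤ := con 1ℤ :+ (con 1ℤ :+ c) :* z) ≈-refl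
         z (const (+ length us)) ⟩
  1# + (1# + const (+ length us)) * z
    ≈⟨ +-congˡ (*-congʳ (const-suc (length us))) ⟩
  1# + const (+ suc (length us)) * z ∎
  where adj? = Graph.adj? (completeGraph k)

catMaybes-just : ∀ {A : Set} (xs : List A) → catMaybes (map just xs) ≡ xs
catMaybes-just []       = refl
catMaybes-just (x ∷ xs) = cong (x ∷_) (catMaybes-just xs)

-- Deletion recurrence at the torso: removing it separates a clique on `m` vertices from the legs,
-- while choosing it removes the clique and the first vertex of each leg.
independence-pineapple : ∀ m μ z →
  independence (Graph.adj? (pineapple (suc m) μ)) z (Graph.vertices (pineapple (suc m) μ)) ≈
  pineapplePolynomial m (Partition.parts μ) z
independence-pineapple m μ z = begin
  independence adj? z (torso ∷ map inj₁ others ++ map inj₂ (catMaybes (map just (legVertices ks))))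
    ≡⟨ cong (λ vs → independence adj? z (torso ∷ map inj₁ others ++ map inj₂ vs))
         (catMaybes-just (legVertices ks)) ⟩
  independence adj? z (torso ∷ map inj₁ others ++ map inj₂ (legVertices ks))
    ≈⟨ independence-∷ adj? z torso (map inj₁ others ++ map inj₂ (legVertices ks)) ⟩
  independence adj? z (map inj₁ others ++ map inj₂ (legVertices ks))
  + z * independence adj? z (filter (nonadjacent? adj? torso) (map inj₁ others ++ map inj₂ (legVertices ks)))
    ≈⟨ +-cong without-torso (*-congˡ with-torso) ⟩
  (1# + const (+ m) * z) * paths z ks + z * shortened z ks ∎
  where
  ks = Partition.parts μ
  adj? = Graph.adj? (pineapple (suc m) μ)
  others = tabulate {n = m} suc
  torso : Fin (suc m) ⊎ LegVertex ks
  torso = inj₁ zero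

  independence-inj₂ : ∀ vs → independence adj? z (map inj₂ vs) ≡ independence (legEdge? ks) z vs
  independence-inj₂ = independence-map adj? (legEdge? ks) inj₂ id id z

  without-torso : independence adj? z (map inj₁ others ++ map inj₂ (legVertices ks)) ≈
                  (1# + const (+ m) * z) * paths z ks
  without-torso = begin
    independence adj? z (map inj₁ others ++ map inj₂ (legVertices ks))
      ≈⟨ independence-++ adj? z (map inj₁ others) (map inj₂ (legVertices ks))
           (All.map⁺ (All.tabulate⁺ (λ _ → All.map⁺ (All.universal (λ { _ (() , _) }) (legVertices ks))))) ⟩
    independence adj? z (map inj₁ others) * independence adj? z (map inj₂ (legVertices ks))
      ≡⟨ cong₂ _*_ (independence-map adj? (Graph.adj? (completeGraph (suc m))) inj₁ id id z others)
                   (independence-inj₂ (legVertices ks)) ⟩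
    independence (Graph.adj? (completeGraph (suc m))) z others * independence (legEdge? ks) z (legVertices ks)
      ≈⟨ *-cong (independence-complete z others (Unique.tabulate⁺ Fin.suc-injective)) (independence-legs ks z) ⟩
    (1# + const (+ length others) * z) * paths z ks
      ≡⟨ cong (λ l → (1# + const (+ l) * z) * paths z ks) (length-tabulate {n = m} suc) ⟩
    (1# + const (+ m) * z) * paths z ks ∎

  with-torso : independence adj? z
    (filter (nonadjacent? adj? torso) (map inj₁ others ++ map inj₂ (legVertices ks))) ≈ shortened z ks
  with-torso = begin
    independence adj? z (filter (nonadjacent? adj? torso) (map inj₁ others ++ map inj₂ (legVertices ks)))
      ≡⟨ cong (independence adj? z) (trans
           (filter-++ (nonadjacent? adj? torso) (map inj₁ others) _)
           (cong₂ _++_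
             (filter-none (nonadjacent? adj? torso) {xs = map inj₁ others}
               (All.map⁺ (All.tabulate⁺ (λ _ nonadj → nonadj (λ ())))))
             (trans (filter-map (nonadjacent? adj? torso) inj₂ (legVertices ks))
               (cong (map inj₂) (filter-≐ (nonadjacent? adj? torso ∘ inj₂) (beyondFirst? ks)
                 ( (λ nonadj first → nonadj (refl , inj₁ first))
                 , (λ { beyond (_ , inj₁ first) → beyond first }))
                 (legVertices ks)))))) ⟩
    independence adj? z (map inj₂ (filter (beyondFirst? ks) (legVertices ks)))
      ≡⟨ independence-inj₂ (filter (beyondFirst? ks) (legVertices ks)) ⟩
    independence (legEdge? ks) z (filter (beyondFirst? ks) (legVertices ks))
      ≈⟨ independence-legs-beyondFirst ks z ⟩
    shortened z ks ∎

-- Coefficients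

ofLength : {V : Set} → List (List V) → ℕ → ℕ
ofLength Ss j = length (filter (λ S → length S ℕ.≟ j) Ss)

-- Written with `≡ᵇ`, to which the test `≟` in `ofLength` computes, so that one case split settles
-- both.
δ : ℕ → ℕ → ℕ
δ l j = if l ℕ.≡ᵇ j then 1 else 0

ofLength-∷ : ∀ {V : Set} (S : List V) Ss j → ofLength (S ∷ Ss) j ≡ δ (length S) j ℕ.+ ofLength Ss j
ofLength-∷ S Ss j with length S ℕ.≡ᵇ j
... | true  = refl
... | false = refl

-- The polynomial y - x.
seed : Array
seed 0 1 = 1ℤ
seed 1 0 = ℤ.- 1ℤ
seed _ _ = 0ℤ

seed⁺ : Alternating seed
seed⁺ = record { antisym = anti ; nonneg = pos }
  where
  anti : ∀ i j → seed j i ≡ ℤ.- seed i j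
  anti 0             0             = refl
  anti 0             1             = refl
  anti 0             (suc (suc j)) = refl
  anti 1             0             = refl
  anti 1             1             = refl
  anti 1             (suc (suc j)) = refl
  anti (suc (suc i)) 0             = refl
  anti (suc (suc i)) 1             = refl
  anti (suc (suc i)) (suc (suc j)) = refl
  pos : ∀ i j → i ℕ.< j → 0ℤ ℤ.≤ seed i j
  pos 0             1             _         = ℤ.+≤+ ℕ.z≤n
  pos 0             (suc (suc j)) _         = ℤ.≤-refl
  pos 1             (suc j)       _         = ℤ.≤-refl
  pos (suc (suc i)) j             _         = ℤ.≤-refl

-- Since y^l (y - x) = y^(l+1) - x y^l, only rows 0 and 1 are nonzero.
Y^-seed : ∀ l j → act (Y ^ l) seed 0 (suc j) ≡ + δ l j
Y^-seed zero          zero    = refl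
Y^-seed zero          (suc j) = refl
Y^-seed (suc zero)    zero    = refl
Y^-seed (suc (suc l)) zero    = refl
Y^-seed (suc l)       (suc j) = Y^-seed l j

Y^-seed-1 : ∀ l j → act (Y ^ l) seed 1 j ≡ ℤ.- + δ l j
Y^-seed-1 zero    zero    = refl
Y^-seed-1 zero    (suc j) = refl
Y^-seed-1 (suc l) zero    = refl
Y^-seed-1 (suc l) (suc j) = Y^-seed-1 l j

Y^-seed-≥2 : ∀ l i j → act (Y ^ l) seed (2 ℕ.+ i) j ≡ 0ℤ
Y^-seed-≥2 zero    i j       = refl
Y^-seed-≥2 (suc l) i zero    = refl
Y^-seed-≥2 (suc l) i (suc j) = Y^-seed-≥2 l i j

module _ {V : Set} where

  weight-seed-0 : ∀ (Ss : List (List V)) j → act (weight Y Ss) seed 0 (suc j) ≡ + ofLength Ss j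
  weight-seed-0 []       j = refl
  weight-seed-0 (S ∷ Ss) j = trans (cong₂ ℤ._+_ (Y^-seed (length S) j) (weight-seed-0 Ss j))
                                     (cong +_ (sym (ofLength-∷ S Ss j)))

  weight-seed-1 : ∀ (Ss : List (List V)) j → act (weight Y Ss) seed 1 j ≡ ℤ.- + ofLength Ss j
  weight-seed-1 []       j = refl
  weight-seed-1 (S ∷ Ss) j = trans (cong₂ ℤ._+_ (Y^-seed-1 (length S) j) (weight-seed-1 Ss j))
    (trans (sym (ℤ.neg-distrib-+ (+ δ (length S) j) (+ ofLength Ss j)))
             (cong (λ c → ℤ.- + c) (sym (ofLength-∷ S Ss j))))

  weight-seed-≥2 : ∀ (Ss : List (List V)) i j → act (weight Y Ss) seed (2 ℕ.+ i) j ≡ 0ℤ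
  weight-seed-≥2 []       i j = refl
  weight-seed-≥2 (S ∷ Ss) i j = cong₂ ℤ._+_ (Y^-seed-≥2 (length S) i j) (weight-seed-≥2 Ss i j)

  module _ {w : Array} (w-≥2 : ∀ i j → w (2 ℕ.+ i) j ≡ 0ℤ) where

    X^-zero : ∀ l j → act (X ^ l) w 0 j ≡ + δ l 0 ℤ.* w 0 j
    X^-zero zero    j = refl
    X^-zero (suc l) j = refl

    X^-two-rows : ∀ l k j → act (X ^ l) w (suc k) j ≡ + δ l (suc k) ℤ.* w 0 j ℤ.+ + δ l k ℤ.* w 1 j
    X^-two-rows zero    zero    j = sym (ℤ.+-identityˡ (1ℤ ℤ.* w 1 j))
    X^-two-rows zero    (suc k) j = cong (1ℤ ℤ.*_) (w-≥2 k j)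
    X^-two-rows (suc l) zero    j = trans (X^-zero l j) (sym (ℤ.+-identityʳ (+ δ l 0 ℤ.* w 0 j)))
    X^-two-rows (suc l) (suc k) j = X^-two-rows l k j

    -- x^l moves row 0 to row l and row 1 to row l + 1, so row k + 1 receives row 0 from sets of
    -- size k + 1 and row 1 from sets of size k.
    weight-two-rows : ∀ (Ss : List (List V)) k j → act (weight X Ss) w (suc k) j ≡
                      + ofLength Ss (suc k) ℤ.* w 0 j ℤ.+ + ofLength Ss k ℤ.* w 1 j
    weight-two-rows []       k j = refl
    weight-two-rows (S ∷ Ss) k j = trans
      (cong₂ ℤ._+_ (X^-two-rows (length S) k j) (weight-two-rows Ss k j))
      (trans (distribute (+ δ (length S) (suc k)) (+ δ (length S) k)
                  (+ ofLength Ss (suc k)) (+ ofLength Ss k) (w 0 j) (w 1 j))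
        (cong₂ (λ c d → + c ℤ.* w 0 j ℤ.+ + d ℤ.* w 1 j)
          (sym (ofLength-∷ S Ss (suc k))) (sym (ofLength-∷ S Ss k))))
      where
      distribute : ∀ a b c d x y → (a ℤ.* x ℤ.+ b ℤ.* y) ℤ.+ (c ℤ.* x ℤ.+ d ℤ.* y) ≡
                   (a ℤ.+ c) ℤ.* x ℤ.+ (b ℤ.+ d) ℤ.* y
      distribute = solve-∀

  weight-minor : ∀ (Ss : List (List V)) k → act (weight X Ss * weight Y Ss) seed (suc k) (2 ℕ.+ k) ≡
                 + (ofLength Ss (suc k) ℕ.* ofLength Ss (suc k))
                 ℤ.- + (ofLength Ss k ℕ.* ofLength Ss (2 ℕ.+ k))
  weight-minor Ss k = trans (weight-two-rows (weight-seed-≥2 Ss) Ss k (2 ℕ.+ k))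
    (trans (cong₂ (λ x y → + c₁ ℤ.* x ℤ.+ + c₀ ℤ.* y)
               (weight-seed-0 Ss (suc k)) (weight-seed-1 Ss (2 ℕ.+ k)))
      (cong₂ ℤ._+_ (sym (ℤ.pos-* c₁ c₁))
        (trans (sym (ℤ.neg-distribʳ-* (+ c₀) (+ c₂))) (cong ℤ.-_ (sym (ℤ.pos-* c₀ c₂))))))
    where
    c₀ = ofLength Ss k
    c₁ = ofLength Ss (suc k)
    c₂ = ofLength Ss (2 ℕ.+ k)

  positive-weight⇒log-concave : ∀ (Ss : List (List V)) → Positive (weight X Ss * weight Y Ss) →
    ∀ k → ofLength Ss k ℕ.* ofLength Ss (2 ℕ.+ k) ℕ.≤ ofLength Ss (suc k) ℕ.* ofLength Ss (suc k)
  positive-weight⇒log-concave Ss W⁺ k = ℤ.drop‿+≤+ (ℤ.0≤i-j⇒j≤i (subst (0ℤ ℤ.≤_) (weight-minor Ss k)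
    (Alternating.nonneg (Positive.preserves W⁺ seed⁺) (suc k) (2 ℕ.+ k) (ℕ.n<1+n (suc k)))))

coeff-map-applyUpTo : ∀ (f g : ℕ → ℕ) d j → j ℕ.< d → coeff (map f (applyUpTo g d)) j ≡ f (g j)
coeff-map-applyUpTo f g (suc d) zero    _         = refl
coeff-map-applyUpTo f g (suc d) (suc j) (s≤s j<d) = coeff-map-applyUpTo f (g ∘ suc) d j j<d

log-concave : ∀ (f : ℕ → ℕ) d → (∀ k → f k ℕ.* f (2 ℕ.+ k) ℕ.≤ f (suc k) ℕ.* f (suc k)) →
              LogConcave (map f (upTo d))
log-concave f d f-lc (suc k) _ 2+k<len = subst₂ ℕ._≤_
  (cong₂ ℕ._*_ (sym (coeff-at k (ℕ.<-trans (ℕ.n<1+n k) 1+k<d))) (sym (coeff-at (2 ℕ.+ k) 2+k<d)))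
  -- The square `c ^ 2` unfolds to `c * (c * 1)`.
  (trans (cong (λ c → c ℕ.* c) (sym (coeff-at (suc k) 1+k<d)))
           (cong (coeff (map f (upTo d)) (suc k) ℕ.*_) (sym (ℕ.*-identityʳ _))))
  (f-lc k)
  where
  2+k<d : 2 ℕ.+ k ℕ.< d
  2+k<d = subst (2 ℕ.+ k ℕ.<_) (trans (length-map f (upTo d)) (length-applyUpTo id d)) 2+k<len
  1+k<d : 1 ℕ.+ k ℕ.< d
  1+k<d = ℕ.<-trans (ℕ.n<1+n (suc k)) 2+k<d
  coeff-at : ∀ j → j ℕ.< d → coeff (map f (upTo d)) j ≡ f j
  coeff-at = coeff-map-applyUpTo f id d

theorem3p5 : (n : ℕ) .{{_ : NonZero n}} (μ : Partition) →
    LogConcave (independencePolynomial (pineapple n μ))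
theorem3p5 (suc m) μ = log-concave (independentSetCount G) (suc (independenceNumber G))
  -- `ofLength (independentSets G)` unfolds to `independentSetCount G`, and
  -- `weight z (independentSets G)` is the left side of `independence-pineapple`.
  (positive-weight⇒log-concave (independentSets G)
    (positive-resp-≈ (*-cong (≈-sym (independence-pineapple m μ X)) (≈-sym (independence-pineapple m μ Y)))
      (pineapplePolynomial⁺ m (Partition.parts μ))))
  where G = pineapple (suc m) μ
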